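{- Let $G$ be a finite simple 2-connected graph with minimum degree $\delta$, let $p$ be the order (number of vertices) of a longest path in $G$, and let $c$ be the circumference of $G$ (the order of a longest cycle in $G$). Then $$ c\ge\begin{cases} p & \text{if } p\le 2\delta,\\[2pt] p-1 & \text{if } 2\delta+1\le p\le 3\delta-2,\\[2pt] \sqrt{2p-10+\left(\delta-\frac{7}{2}\right)^2}+\delta+\frac{1}{2} & \text{if } p\ge 3\delta-1. \end{cases} $$
   Context: Graphs are finite, undirected, without loops or multiple edges. The order of a path or cycle is its number of vertices. -}

module Defs where

open import Data.Nat using (ℕ; _≤_)
open import Data.Bool using (Bool; true; false; T)
open import Data.Fin using (Fin)
open import Data.List using (List; []; _∷_; [_]; _++_; length; filterᵇ; allFin)
open import Data.List.Relation.Unary.Unique.Propositional using (Unique)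
open import Data.Product using (Σ; _×_; ∃)
open import Data.Unit using (⊤)
open import Data.Empty using (⊥)
open import Relation.Binary.PropositionalEquality using (_≡_; _≢_)

record Graph (n : ℕ) : Set where
  field
    adj    : Fin n → Fin n → Bool
    sym    : ∀ u v → adj u v ≡ adj v u
    irrefl : ∀ v → adj v v ≡ false
open Graph public

Adj : ∀ {n} → Graph n → Fin n → Fin n → Set
Adj G u v = T (adj G u v)

degree : ∀ {n} → Graph n → Fin n → ℕ
degree {n} G v = length (filterᵇ (adj G v) (allFin n))

MinDegree : ∀ {n} → Graph n → ℕ → Set
MinDegree G δ = (∃ λ v → degree G v ≡ δ) × (∀ v → δ ≤ degree G v)

data Chain {n} (G : Graph n) : List (Fin n) → Set where
  nil  : Chain G []
  one  : ∀ x → Chain G [ x ]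
  cons : ∀ {x y xs} → Adj G x y → Chain G (y ∷ xs) → Chain G (x ∷ y ∷ xs)

IsPath : ∀ {n} → Graph n → List (Fin n) → Set
IsPath G []       = ⊥
IsPath G (x ∷ xs) = Unique (x ∷ xs) × Chain G (x ∷ xs)

IsCycle : ∀ {n} → Graph n → List (Fin n) → Set
IsCycle G []       = ⊥
IsCycle G (x ∷ ys) = 3 ≤ length (x ∷ ys) × Unique (x ∷ ys) × Chain G ((x ∷ ys) ++ [ x ])

LongestPathOrder : ∀ {n} → Graph n → ℕ → Set
LongestPathOrder G p =
  (∃ λ xs → IsPath G xs × length xs ≡ p) × (∀ xs → IsPath G xs → length xs ≤ p)

Circumference : ∀ {n} → Graph n → ℕ → Set
Circumference G c =
  (∃ λ xs → IsCycle G xs × length xs ≡ c) × (∀ xs → IsCycle G xs → length xs ≤ c)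

data Walk {n} (G : Graph n) (P : Fin n → Set) : Fin n → Fin n → Set where
  here : ∀ {u} → P u → Walk G P u u
  step : ∀ {u w v} → P u → Adj G u w → Walk G P w v → Walk G P u v

Connected : ∀ {n} → Graph n → Set
Connected {n} G = ∀ (u v : Fin n) → Walk G (λ _ → ⊤) u v

TwoConnected : ∀ {n} → Graph n → Set
TwoConnected {n} G =
  3 ≤ n × Connected G ×
  (∀ (x u v : Fin n) → u ≢ x → v ≢ x → Walk G (λ w → w ≢ x) u v)

{-# OPTIONS --safe #-}
module Submission where

-- Let the longest path be v 0, …, v L, so p = L + 1, and suppose c < p.
--
-- Among all longest paths and chords from their first vertex v 0 to a vertex v e
-- choose one with e maximal: a cycle v 0 … v e with a tail v (e+1) … v L.  Every
-- longest path then has all neighbours of its first vertex among its first e + 1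
-- vertices.  If e + 1 < 2δ, Ore's argument gives a Hamiltonian path of the cycle from
-- v e to each v k with k < e, so no v k has a neighbour outside the cycle and v e is a
-- cut vertex.  Hence c ≥ e + 1 ≥ 2δ.  If v L has at most one neighbour on the cycle,
-- the tail has at least δ vertices and p ≥ 3δ.  Otherwise, after reversing the tail, the
-- vertex next to the cycle has two neighbours x, x′ on it, and counting the neighbours
-- of the successors of x and x′ and of v L along the cycle gives 3δ ≤ p + 1,
-- unless there is a cycle with at least p - 1 vertices.
--
-- For the quadratic bound, cover the path by ears (Dirac's vine), each chosen to reach as
-- far as possible.  The cycle using all m ears contains all neighbours of the two ends,
-- so c ≥ 2δ + m - 2.  The gaps between consecutive ears are bounded by the cycles
-- formed by a single ear and by all ears but the first and the last, which gives
-- 2p ≤ (m + 1) (c - 4) + 10.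
--
-- The conclusions are decidable, so maxima are taken inside a double negation.

open import Defs hiding (sym)
open import Algebra.Properties.CommutativeSemigroup using (interchange)
open import Data.Bool.Base using (Bool; true; false; T; if_then_else_; _∧_)
open import Data.Bool.Properties using (T?; T-∧)
open import Data.Empty using (⊥; ⊥-elim)
open import Data.Fin.Base using (Fin; zero; suc)
import Data.Fin.Properties as Fin
import Data.Integer.Base as ℤ
import Data.Integer.Properties as ℤ
open import Data.Integer.Tactic.RingSolver using (solve-∀)
open import Data.List.Base using (List; []; _∷_; [_]; _++_; map; length; filterᵇ; allFin; reverse)
import Data.List.Membership.DecPropositional as DecMembership
open import Data.List.Membership.Propositional using (_∈_)
open import Data.List.Membership.Propositional.Properties using (∈-++⁺ˡ; ∈-++⁺ʳ; ∈-++⁻; ∈-∃++; ∈-filter⁺; ∈-filter⁻; ∈-allFin)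
open import Data.List.Properties using (length-++; length-reverse; unfold-reverse)
open import Data.List.Relation.Unary.All as All using (All; []; _∷_)
import Data.List.Relation.Unary.All.Properties as All
open import Data.List.Relation.Unary.AllPairs using ([]; _∷_)
import Data.List.Relation.Unary.Any.Properties as Any
open import Data.List.Relation.Unary.Any using (here; there)
open import Data.List.Relation.Unary.Unique.Propositional using (Unique)
import Data.List.Relation.Unary.Unique.Propositional.Properties as Unique
open import Data.Nat.Base using (ℕ; zero; suc; _+_; _*_; _∸_; _≤_; _<_; z≤n; s≤s)
open import Data.Nat.Properties
open import Data.Product.Base using (∃; _×_; _,_; proj₁; proj₂)
open import Data.Sum.Base using (_⊎_; inj₁; inj₂)
open import Data.Unit.Base using (⊤)
open import Data.Vec.Base as Vec using (Vec; []; _∷_; lookup; replicate; zipWith)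
open import Data.Vec.N-ary using (N-ary; _$ⁿ_)
open import Function.Base using (_∘_; id)
open import Function.Bundles using (Equivalence)
open import Relation.Binary.Definitions using (tri<; tri≈; tri>)
open import Relation.Binary.PropositionalEquality using (_≡_; _≢_; refl; sym; trans; cong; cong₂; subst; subst₂)
open import Relation.Nullary using (¬_; yes; no)
open import Relation.Nullary.Decidable using (¬?; _×-dec_; decidable-stable)

-- Linear arithmetic by Fourier–Motzkin elimination

module LinearArithmetic where

  open import Data.Integer.Base using (ℤ; +_; -[1+_])

  infix 2 _⊢_
  infix 6 _≼_ _≺_ _≈_
  infixl 7 _⊕_
  infixl 8 _⊗_

  data Expr (n : ℕ) : Set where
    var : Fin n → Expr n
    #_  : ℕ → Expr n
    _⊕_ : Expr n → Expr n → Expr n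
    _⊗_ : ℕ → Expr n → Expr n

  ⟦_⟧ : ∀ {n} → Expr n → Vec ℕ n → ℕ
  ⟦ var i ⟧ ρ = lookup ρ i
  ⟦ # k ⟧ ρ   = k
  ⟦ a ⊕ b ⟧ ρ = ⟦ a ⟧ ρ + ⟦ b ⟧ ρ
  ⟦ k ⊗ a ⟧ ρ = k * ⟦ a ⟧ ρ

  data Rel (n : ℕ) : Set where
    _≼_ _≈_ : Expr n → Expr n → Rel n

  _≺_ : ∀ {n} → Expr n → Expr n → Rel n
  a ≺ b = # 1 ⊕ a ≼ b

  ⟦_⟧ᴿ : ∀ {n} → Rel n → Vec ℕ n → Set
  ⟦ a ≼ b ⟧ᴿ ρ = ⟦ a ⟧ ρ ≤ ⟦ b ⟧ ρ
  ⟦ a ≈ b ⟧ᴿ ρ = ⟦ a ⟧ ρ ≡ ⟦ b ⟧ ρ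

  record Problem (n : ℕ) : Set where
    constructor _⊢_
    field
      hyps : List (Rel n)
      goal : Rel n

  -- A row (k , a₁ ∷ … ∷ aₙ) stands for the inequality 0 ≤ k + a₁ x₁ + … + aₙ xₙ.
  Row : ℕ → Set
  Row n = ℤ × Vec ℤ n

  dot : ∀ {n} → Vec ℤ n → Vec ℕ n → ℤ
  dot []       []       = + 0
  dot (a ∷ as) (x ∷ xs) = a ℤ.* + x ℤ.+ dot as xs

  val : ∀ {n} → Row n → Vec ℕ n → ℤ
  val (k , as) ρ = k ℤ.+ dot as ρ

  Valid : ∀ {n} → Vec ℕ n → Row n → Set
  Valid ρ r = + 0 ℤ.≤ val r ρ

  infixl 6 _⊞_
  infixl 7 _⊡_

  _⊞_ : ∀ {n} → Row n → Row n → Row n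
  (k , as) ⊞ (l , bs) = k ℤ.+ l , zipWith ℤ._+_ as bs

  _⊡_ : ∀ {n} → ℤ → Row n → Row n
  z ⊡ (k , as) = z ℤ.* k , Vec.map (z ℤ.*_) as

  constant : ∀ {n} → ℤ → Row n
  constant {n} k = k , replicate n (+ 0)

  unit : ∀ {n} → Fin n → Vec ℤ n
  unit {suc n} zero = + 1 ∷ replicate n (+ 0)
  unit (suc i)      = + 0 ∷ unit i

  linear : ∀ {n} → Expr n → Row n
  linear (var i) = + 0 , unit i
  linear (# k)   = constant (+ k)
  linear (a ⊕ b) = linear a ⊞ linear b
  linear (k ⊗ a) = + k ⊡ linear a

  dot-replicate : ∀ {n} (ρ : Vec ℕ n) → dot (replicate n (+ 0)) ρ ≡ + 0
  dot-replicate []      = refl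
  dot-replicate (x ∷ ρ) = trans (ℤ.+-identityˡ _) (dot-replicate ρ)

  dot-unit : ∀ {n} (i : Fin n) ρ → dot (unit i) ρ ≡ + lookup ρ i
  dot-unit zero    (x ∷ ρ) = trans (cong₂ ℤ._+_ (ℤ.*-identityˡ (+ x)) (dot-replicate ρ)) (ℤ.+-identityʳ (+ x))
  dot-unit (suc i) (x ∷ ρ) = trans (ℤ.+-identityˡ _) (dot-unit i ρ)

  dot-⊞ : ∀ {n} (as bs : Vec ℤ n) ρ → dot (zipWith ℤ._+_ as bs) ρ ≡ dot as ρ ℤ.+ dot bs ρ
  dot-⊞ []       []       []      = refl
  dot-⊞ (a ∷ as) (b ∷ bs) (x ∷ ρ) =
    trans (cong (ℤ._+_ ((a ℤ.+ b) ℤ.* + x)) (dot-⊞ as bs ρ)) (identity a b (+ x) (dot as ρ) (dot bs ρ))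
    where
    identity : ∀ a b x c d → (a ℤ.+ b) ℤ.* x ℤ.+ (c ℤ.+ d) ≡ (a ℤ.* x ℤ.+ c) ℤ.+ (b ℤ.* x ℤ.+ d)
    identity = solve-∀

  dot-⊡ : ∀ {n} z (as : Vec ℤ n) ρ → dot (Vec.map (z ℤ.*_) as) ρ ≡ z ℤ.* dot as ρ
  dot-⊡ z []       []      = sym (ℤ.*-zeroʳ z)
  dot-⊡ z (a ∷ as) (x ∷ ρ) =
    trans (cong (ℤ._+_ (z ℤ.* a ℤ.* + x)) (dot-⊡ z as ρ)) (identity z a (+ x) (dot as ρ))
    where
    identity : ∀ z a x c → z ℤ.* a ℤ.* x ℤ.+ z ℤ.* c ≡ z ℤ.* (a ℤ.* x ℤ.+ c)
    identity = solve-∀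

  val-⊞ : ∀ {n} (r s : Row n) ρ → val (r ⊞ s) ρ ≡ val r ρ ℤ.+ val s ρ
  val-⊞ (k , as) (l , bs) ρ =
    trans (cong (ℤ._+_ (k ℤ.+ l)) (dot-⊞ as bs ρ)) (identity k l (dot as ρ) (dot bs ρ))
    where
    identity : ∀ k l c d → k ℤ.+ l ℤ.+ (c ℤ.+ d) ≡ (k ℤ.+ c) ℤ.+ (l ℤ.+ d)
    identity = solve-∀

  val-⊡ : ∀ {n} z (r : Row n) ρ → val (z ⊡ r) ρ ≡ z ℤ.* val r ρ
  val-⊡ z (k , as) ρ =
    trans (cong (ℤ._+_ (z ℤ.* k)) (dot-⊡ z as ρ)) (sym (ℤ.*-distribˡ-+ z k (dot as ρ)))

  val-linear : ∀ {n} (e : Expr n) ρ → val (linear e) ρ ≡ + ⟦ e ⟧ ρ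
  val-linear (var i) ρ = trans (ℤ.+-identityˡ _) (dot-unit i ρ)
  val-linear (# k)   ρ = trans (cong (ℤ._+_ (+ k)) (dot-replicate ρ)) (ℤ.+-identityʳ (+ k))
  val-linear (a ⊕ b) ρ = trans (val-⊞ (linear a) (linear b) ρ) (cong₂ ℤ._+_ (val-linear a ρ) (val-linear b ρ))
  val-linear (k ⊗ a) ρ =
    trans (val-⊡ (+ k) (linear a) ρ)
          (trans (cong (ℤ._*_ (+ k)) (val-linear a ρ)) (sym (ℤ.pos-* k _)))

  difference : ∀ {n} → Expr n → Expr n → Row n
  difference a b = linear b ⊞ (ℤ.- + 1 ⊡ linear a)

  difference-valid : ∀ {n} (a b : Expr n) ρ → ⟦ a ⟧ ρ ≤ ⟦ b ⟧ ρ → Valid ρ (difference a b)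
  difference-valid a b ρ a≤b = subst (+ 0 ℤ.≤_) (sym eq) (ℤ.i≤j⇒0≤j-i (ℤ.+≤+ a≤b))
    where
    eq : val (difference a b) ρ ≡ + ⟦ b ⟧ ρ ℤ.- + ⟦ a ⟧ ρ
    eq = trans (val-⊞ (linear b) _ ρ)
        (cong₂ ℤ._+_ (val-linear b ρ)
          (trans (val-⊡ (ℤ.- + 1) (linear a) ρ)
                 (trans (cong (ℤ._*_ (ℤ.- + 1)) (val-linear a ρ)) (ℤ.-1*i≡-i _))))

  nonNegᵇ : ℤ → Bool
  nonNegᵇ (+ _)    = true
  nonNegᵇ -[1+ _ ] = false

  trivialᵛ : ∀ {n} → Vec ℤ n → Bool
  trivialᵛ []       = true
  trivialᵛ (a ∷ as) = nonNegᵇ a ∧ trivialᵛ as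

  -- Rows with no negative entry hold for all natural numbers. Dropping them keeps the number of
  -- combinations small.
  prune : ∀ {n} → List (Row n) → List (Row n)
  prune []              = []
  prune ((k , as) ∷ rs) = if nonNegᵇ k ∧ trivialᵛ as then prune rs else (k , as) ∷ prune rs

  prune-valid : ∀ {n} {ρ : Vec ℕ n} {rs} → All (Valid ρ) rs → All (Valid ρ) (prune rs)
  prune-valid []                                  = []
  prune-valid {rs = (k , as) ∷ rs} (p ∷ ps) with nonNegᵇ k ∧ trivialᵛ as
  ... | true  = prune-valid ps
  ... | false = p ∷ prune-valid ps

  -- The rows without the first variable, and those in which it has a
  -- coefficient + suc a or -[1+ a ], listed with a.
  record Split (n : ℕ) : Set where
    constructor split
    field
      none     : List (Row n)
      pos neg  : List (ℕ × Row n)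

  splitRows : ∀ {n} → List (Row (suc n)) → Split n
  splitRows []                           = split [] [] []
  splitRows ((k , + 0 ∷ as) ∷ rs)        = let split z p m = splitRows rs in split ((k , as) ∷ z) p m
  splitRows ((k , + (suc a) ∷ as) ∷ rs)  = let split z p m = splitRows rs in split z ((a , k , as) ∷ p) m
  splitRows ((k , -[1+ a ] ∷ as) ∷ rs)   = let split z p m = splitRows rs in split z p ((a , k , as) ∷ m)

  -- Each of the two rows is multiplied by the size of the other's leading coefficient, which is
  -- stored less one, so that the first variable cancels.
  combine : ∀ {n} → List (ℕ × Row n) → ℕ × Row n → List (Row n)
  combine []             m       = []
  combine ((a , r) ∷ ps) (b , s) = (+ suc b ⊡ r ⊞ + suc a ⊡ s) ∷ combine ps (b , s)

  combineAll : ∀ {n} → List (ℕ × Row n) → List (ℕ × Row n) → List (Row n)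
  combineAll p []      = []
  combineAll p (q ∷ m) = combine p q ++ combineAll p m

  -- A row with a negative coefficient stays valid without that term, because the
  -- variables are natural numbers.  To limit the number of rows, this is used only
  -- if there is nothing to combine the row with.
  eliminate : ∀ {n} → Split n → List (Row n)
  eliminate (split z []      m) = z ++ map proj₂ m
  eliminate (split z (q ∷ p) m) = z ++ combineAll (q ∷ p) m

  refuted : ∀ {n} → List (Row n) → Bool
  refuted {zero}  []                    = false
  refuted {zero}  ((+ _ , []) ∷ rs)     = refuted rs
  refuted {zero}  ((-[1+ _ ] , []) ∷ _) = true
  refuted {suc n} rs                    = refuted (prune (eliminate (splitRows rs)))

  PosValid NegValid : ∀ {n} → ℕ → Vec ℕ n → ℕ × Row n → Set
  PosValid x ρ (a , r) = + 0 ℤ.≤ + suc a ℤ.* + x ℤ.+ val r ρ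
  NegValid x ρ (a , r) = + 0 ℤ.≤ -[1+ a ] ℤ.* + x ℤ.+ val r ρ

  record SplitValid {n} (x : ℕ) (ρ : Vec ℕ n) (s : Split n) : Set where
    constructor splitValid
    field
      none-valid : All (Valid ρ) (Split.none s)
      pos-valid  : All (PosValid x ρ) (Split.pos s)
      neg-valid  : All (NegValid x ρ) (Split.neg s)

  regroup : ∀ k a d → k ℤ.+ (a ℤ.+ d) ≡ a ℤ.+ (k ℤ.+ d)
  regroup = solve-∀

  splitRows-valid : ∀ {n x} {ρ : Vec ℕ n} rs → All (Valid (x ∷ ρ)) rs → SplitValid x ρ (splitRows rs)
  splitRows-valid [] [] = splitValid [] [] []
  splitRows-valid {x = x} {ρ} ((k , + 0 ∷ as) ∷ rs) (p ∷ ps) =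
    let splitValid z q m = splitRows-valid rs ps in
    splitValid (subst (+ 0 ℤ.≤_) (cong (ℤ._+_ k) (ℤ.+-identityˡ (dot as ρ))) p ∷ z) q m
  splitRows-valid {x = x} {ρ} ((k , + (suc a) ∷ as) ∷ rs) (p ∷ ps) =
    let splitValid z q m = splitRows-valid rs ps in
    splitValid z (subst (+ 0 ℤ.≤_) (regroup k (+ suc a ℤ.* + x) (dot as ρ)) p ∷ q) m
  splitRows-valid {x = x} {ρ} ((k , -[1+ a ] ∷ as) ∷ rs) (p ∷ ps) =
    let splitValid z q m = splitRows-valid rs ps in
    splitValid z q (subst (+ 0 ℤ.≤_) (regroup k (-[1+ a ] ℤ.* + x) (dot as ρ)) p ∷ m)

  combine-valid : ∀ {n} x {ρ : Vec ℕ n} ps {m} → All (PosValid x ρ) ps → NegValid x ρ m →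
                  All (Valid ρ) (combine ps m)
  combine-valid x [] [] q = []
  combine-valid x {ρ} ((a , r) ∷ ps) {b , s} (p ∷ qs) q =
    subst (+ 0 ℤ.≤_) eq
      (ℤ.+-mono-≤ (scale (suc b) p) (scale (suc a) q)) ∷ combine-valid x ps qs q
    where
    scale : ∀ k {z} → + 0 ℤ.≤ z → + 0 ℤ.≤ + k ℤ.* z
    scale k {z} 0≤z = subst (ℤ._≤ + k ℤ.* z) (ℤ.*-zeroʳ (+ k)) (ℤ.*-monoˡ-≤-nonNeg (+ k) 0≤z)
    identity : ∀ a b x r s → b ℤ.* (a ℤ.* x ℤ.+ r) ℤ.+ a ℤ.* (ℤ.- b ℤ.* x ℤ.+ s) ≡ b ℤ.* r ℤ.+ a ℤ.* s
    identity = solve-∀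
    eq : + suc b ℤ.* (+ suc a ℤ.* + x ℤ.+ val r ρ) ℤ.+ + suc a ℤ.* (-[1+ b ] ℤ.* + x ℤ.+ val s ρ)
         ≡ val (+ suc b ⊡ r ⊞ + suc a ⊡ s) ρ
    eq = trans (identity (+ suc a) (+ suc b) (+ x) (val r ρ) (val s ρ))
           (sym (trans (val-⊞ (+ suc b ⊡ r) (+ suc a ⊡ s) ρ)
                       (cong₂ ℤ._+_ (val-⊡ (+ suc b) r ρ) (val-⊡ (+ suc a) s ρ))))

  drop-negative : ∀ {n} x {ρ : Vec ℕ n} {m} → NegValid x ρ m → Valid ρ (proj₂ m)
  drop-negative x {ρ} {b , s} q =
    ℤ.≤-trans q (subst (-[1+ b ] ℤ.* + x ℤ.+ val s ρ ℤ.≤_) (ℤ.+-identityˡ (val s ρ))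
      (ℤ.+-monoˡ-≤ (val s ρ) nonPositive))
    where
    nonPositive : -[1+ b ] ℤ.* + x ℤ.≤ + 0
    nonPositive = subst (-[1+ b ] ℤ.* + x ℤ.≤_) (ℤ.*-zeroʳ -[1+ b ])
                    (ℤ.*-monoˡ-≤-nonPos -[1+ b ] {+ 0} {+ x} (ℤ.+≤+ z≤n))

  combineAll-valid : ∀ {n} x {ρ : Vec ℕ n} p m → All (PosValid x ρ) p → All (NegValid x ρ) m →
                     All (Valid ρ) (combineAll p m)
  combineAll-valid x p []      pv []       = []
  combineAll-valid x p (q ∷ m) pv (qv ∷ mv) = All.++⁺ (combine-valid x p pv qv) (combineAll-valid x p m pv mv)

  drop-negatives : ∀ {n} x {ρ : Vec ℕ n} m → All (NegValid x ρ) m → All (Valid ρ) (map proj₂ m)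
  drop-negatives x []      []       = []
  drop-negatives x (q ∷ m) (qv ∷ mv) = drop-negative x {m = q} qv ∷ drop-negatives x m mv

  eliminate-valid : ∀ {n} x {ρ : Vec ℕ n} s → SplitValid x ρ s → All (Valid ρ) (eliminate s)
  eliminate-valid x (split z []      m) (splitValid zv pv mv) = All.++⁺ zv (drop-negatives x m mv)
  eliminate-valid x (split z (q ∷ p) m) (splitValid zv pv mv) = All.++⁺ zv (combineAll-valid x (q ∷ p) m pv mv)

  refute : ∀ {n} (rs : List (Row n)) → T (refuted rs) → ∀ ρ → All (Valid ρ) rs → ⊥
  refute {zero}  ((+ _ , []) ∷ rs)     ok []      (_ ∷ ps) = refute rs ok [] ps
  refute {zero}  ((-[1+ k ] , []) ∷ _) ok []      (p ∷ _)  with subst (+ 0 ℤ.≤_) (ℤ.+-identityʳ -[1+ k ]) p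
  ... | ()
  refute {suc n} rs                    ok (x ∷ ρ) ps       =
    refute (prune (eliminate (splitRows rs))) ok ρ
      (prune-valid (eliminate-valid x (splitRows rs) (splitRows-valid rs ps)))

  rows : ∀ {n} → List (Rel n) → List (Row n)
  rows []             = []
  rows (a ≼ b ∷ hs)   = difference a b ∷ rows hs
  rows (a ≈ b ∷ hs)   = difference a b ∷ difference b a ∷ rows hs

  decideGoal : ∀ {n} → List (Rel n) → Rel n → Bool
  -- The negated goal, `1 + b ≤ a`, joins the hypotheses, and the whole system is refuted.
  decideGoal hs (a ≼ b) = refuted (prune (difference (# 1 ⊕ b) a ∷ rows hs))
  decideGoal hs (a ≈ b) = decideGoal hs (a ≼ b) ∧ decideGoal hs (b ≼ a)

  decide : ∀ {n} → Problem n → Bool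
  decide (hs ⊢ g) = decideGoal hs g

  Meaning : ∀ {n} → List (Rel n) → Rel n → Vec ℕ n → Set
  Meaning []       g ρ = ⟦ g ⟧ᴿ ρ
  Meaning (h ∷ hs) g ρ = ⟦ h ⟧ᴿ ρ → Meaning hs g ρ

  Holds : ∀ {n} → Vec ℕ n → Rel n → Set
  Holds ρ h = ⟦ h ⟧ᴿ ρ

  rows-valid : ∀ {n} (ρ : Vec ℕ n) hs → All (Holds ρ) hs → All (Valid ρ) (rows hs)
  rows-valid ρ []           []       = []
  rows-valid ρ (a ≼ b ∷ hs) (p ∷ ps) = difference-valid a b ρ p ∷ rows-valid ρ hs ps
  rows-valid ρ (a ≈ b ∷ hs) (p ∷ ps) =
    difference-valid a b ρ (≤-reflexive p) ∷ difference-valid b a ρ (≤-reflexive (sym p)) ∷ rows-valid ρ hs ps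

  decideGoal-sound : ∀ {n} (ρ : Vec ℕ n) hs g → T (decideGoal hs g) → All (Holds ρ) hs → ⟦ g ⟧ᴿ ρ
  decideGoal-sound ρ hs (a ≼ b) ok ps with ⟦ a ⟧ ρ ≤? ⟦ b ⟧ ρ
  ... | yes a≤b = a≤b
  ... | no  a≰b = ⊥-elim (refute (prune (difference (# 1 ⊕ b) a ∷ rows hs)) ok ρ
                    (prune-valid (difference-valid (# 1 ⊕ b) a ρ (≰⇒> a≰b) ∷ rows-valid ρ hs ps)))
  decideGoal-sound ρ hs (a ≈ b) ok ps with Equivalence.to (T-∧ {decideGoal hs (a ≼ b)}) ok
  ... | ok₁ , ok₂ = ≤-antisym (decideGoal-sound ρ hs (a ≼ b) ok₁ ps) (decideGoal-sound ρ hs (b ≼ a) ok₂ ps)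

  curryHyps : ∀ {n} (ρ : Vec ℕ n) hs {g} → (All (Holds ρ) hs → ⟦ g ⟧ᴿ ρ) → Meaning hs g ρ
  curryHyps ρ []       k = k []
  curryHyps ρ (h ∷ hs) k = λ p → curryHyps ρ hs (λ ps → k (p ∷ ps))

  close : ∀ n → N-ary n (Expr n) (Problem n) → Problem n
  close n f = f $ⁿ Vec.map var (Vec.allFin n)

  -- Usage: lin n (λ x₁ … xₙ → hyps ⊢ goal) (values of the xᵢ) (proofs of the hyps).  The
  -- search is over the rationals and incomplete; a nonlinear term can be passed as a value.
  lin : ∀ n (f : N-ary n (Expr n) (Problem n)) {ok : T (decide (close n f))} (ρ : Vec ℕ n) →
        Meaning (Problem.hyps (close n f)) (Problem.goal (close n f)) ρ
  lin n f {ok} ρ = curryHyps ρ hyps (decideGoal-sound ρ hyps goal ok)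
    where open Problem (close n f)

open LinearArithmetic using (lin; #_; _⊕_; _⊗_; _≼_; _≺_; _≈_; _⊢_)

-- Classical maxima and lists

em : ∀ {A : Set} → (A ⊎ ¬ A → ⊥) → ⊥
em k = k (inj₂ λ a → k (inj₁ a))

-- `P` need not be decidable, so each round asks `em` for a larger witness. The invariant
-- `b ≤ i + fuel` leaves no room for one when the fuel is spent.
maximum : ∀ (P : ℕ → Set) b → (∀ i → P i → i ≤ b) → ∃ P →
          ((∃ λ m → P m × (∀ i → P i → i ≤ m)) → ⊥) → ⊥
maximum P b bounded (i , Pi) k = go b i Pi (m≤n+m b i)
  where
  go : ∀ fuel i → P i → b ≤ i + fuel → ⊥
  go fuel i Pi b≤ = em λ
    { (inj₂ none) → k (i , Pi , λ j Pj → ≮⇒≥ λ i<j → none (j , i<j , Pj))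
    ; (inj₁ (j , i<j , Pj)) → next fuel b≤ j i<j Pj }
    where
    next : ∀ fuel → b ≤ i + fuel → ∀ j → i < j → P j → ⊥
    next zero    b≤ j i<j Pj =
      <⇒≱ i<j (≤-trans (bounded j Pj) (≤-trans b≤ (≤-reflexive (+-identityʳ i))))
    next (suc f) b≤ j i<j Pj =
      go f j Pj (≤-trans b≤ (≤-trans (≤-reflexive (+-suc i f)) (+-monoˡ-≤ f i<j)))

minimum : ∀ (P : ℕ → Set) → ∃ P → ((∃ λ m → P m × (∀ i → P i → m ≤ i)) → ⊥) → ⊥
minimum P (i , Pi) k = go i i Pi ≤-refl
  where
  go : ∀ fuel i → P i → i ≤ fuel → ⊥
  go fuel i Pi i≤ = em λ
    { (inj₂ none) → k (i , Pi , λ j Pj → ≮⇒≥ λ j<i → none (j , j<i , Pj))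
    ; (inj₁ (j , j<i , Pj)) → next fuel i≤ j j<i Pj }
    where
    next : ∀ fuel → i ≤ fuel → ∀ j → j < i → P j → ⊥
    next zero    i≤ j j<i Pj = <⇒≱ j<i (≤-trans i≤ z≤n)
    next (suc f) i≤ j j<i Pj = go f j Pj (≤-pred (≤-trans j<i i≤))

-- Induction on `xs`, deleting its head from `ys` each time. Uniqueness of `xs` ensures that no
-- later element is lost by the deletion.
unique-⊆-length : ∀ {A : Set} {xs ys : List A} → Unique xs → (∀ {t} → t ∈ xs → t ∈ ys) →
                  length xs ≤ length ys
unique-⊆-length []            _   = z≤n
unique-⊆-length {xs = x ∷ xs} (x∉ ∷ u) xs⊆ with ∈-∃++ (xs⊆ (here refl))
... | as , bs , refl = subst (suc (length xs) ≤_) (sym size) (s≤s (unique-⊆-length u λ t∈ → drop-x t∈ (xs⊆ (there t∈))))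
  where
  size : length (as ++ x ∷ bs) ≡ suc (length (as ++ bs))
  size = trans (length-++ as) (trans (+-suc (length as) (length bs)) (cong suc (sym (length-++ as))))
  drop-x : ∀ {t} → t ∈ xs → t ∈ as ++ x ∷ bs → t ∈ as ++ bs
  drop-x t∈xs t∈ with ∈-++⁻ as t∈
  ... | inj₁ t∈as         = ∈-++⁺ˡ t∈as
  ... | inj₂ (here refl)  = ⊥-elim (All.lookup x∉ t∈xs refl)
  ... | inj₂ (there t∈bs) = ∈-++⁺ʳ as t∈bs

-- The default makes indexing total, so that a path can be handled as a function on ℕ.
nth : ∀ {A : Set} → A → List A → ℕ → A
nth d []       i       = d
nth d (x ∷ xs) zero    = x
nth d (x ∷ xs) (suc i) = nth d xs i

module _ {A : Set} {d : A} where

  nth-∈ : ∀ xs {i} → i < length xs → nth d xs i ∈ xs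
  nth-∈ (x ∷ xs) {zero}  _       = here refl
  nth-∈ (x ∷ xs) {suc i} (s≤s p) = there (nth-∈ xs p)

  ∈-nth : ∀ {xs t} → t ∈ xs → ∃ λ i → i < length xs × nth d xs i ≡ t
  ∈-nth (here refl) = 0 , s≤s z≤n , refl
  ∈-nth (there t∈) with ∈-nth t∈
  ... | i , i< , eq = suc i , s≤s i< , eq

  nth-injective : ∀ {xs i j} → Unique xs → i < length xs → j < length xs → nth d xs i ≡ nth d xs j → i ≡ j
  nth-injective {x ∷ xs} {zero}  {zero}  _        _       _       _  = refl
  nth-injective {x ∷ xs} {zero}  {suc j} (x∉ ∷ _) _       (s≤s q) eq = ⊥-elim (All.lookup x∉ (nth-∈ xs q) eq)
  nth-injective {x ∷ xs} {suc i} {zero}  (x∉ ∷ _) (s≤s p) _       eq = ⊥-elim (All.lookup x∉ (nth-∈ xs p) (sym eq))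
  nth-injective {x ∷ xs} {suc i} {suc j} (_ ∷ u)  (s≤s p) (s≤s q) eq = cong suc (nth-injective u p q eq)

  nth-++ˡ : ∀ xs {ys i} → i < length xs → nth d (xs ++ ys) i ≡ nth d xs i
  nth-++ˡ (x ∷ xs) {i = zero}  _       = refl
  nth-++ˡ (x ∷ xs) {i = suc i} (s≤s p) = nth-++ˡ xs p

  nth-++ʳ : ∀ xs {ys i} → nth d (xs ++ ys) (length xs + i) ≡ nth d ys i
  nth-++ʳ []       = refl
  nth-++ʳ (x ∷ xs) = nth-++ʳ xs

-- Counting along an interval

indicator : Bool → ℕ
indicator true  = 1
indicator false = 0

indicator-≤1 : ∀ a → indicator a ≤ 1
indicator-≤1 true  = ≤-refl
indicator-≤1 false = z≤n

indicator-¬ : ∀ a → ¬ T a → indicator a ≡ 0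
indicator-¬ true  ¬a = ⊥-elim (¬a _)
indicator-¬ false ¬a = refl

exclusive₂ : ∀ a b → (T a → T b → ⊥) → indicator a + indicator b ≤ 1
exclusive₂ true  true  ab = ⊥-elim (ab _ _)
exclusive₂ true  false ab = ≤-refl
exclusive₂ false b     ab = indicator-≤1 b

exclusive₃ : ∀ a b c → (T a → T b → ⊥) → (T a → T c → ⊥) → (T b → T c → ⊥) →
             indicator a + indicator b + indicator c ≤ 1
exclusive₃ true  true  c     ab ac bc = ⊥-elim (ab _ _)
exclusive₃ true  false true  ab ac bc = ⊥-elim (ac _ _)
exclusive₃ true  false false ab ac bc = ≤-refl
exclusive₃ false b     c     ab ac bc = exclusive₂ b c bc

sumFrom : (ℕ → ℕ) → ℕ → ℕ → ℕ
sumFrom f lo zero    = 0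
sumFrom f lo (suc k) = f lo + sumFrom f (suc lo) k

sumFrom-split : ∀ f lo j k → sumFrom f lo (j + k) ≡ sumFrom f lo j + sumFrom f (lo + j) k
sumFrom-split f lo zero    k = cong (λ i → sumFrom f i k) (sym (+-identityʳ lo))
sumFrom-split f lo (suc j) k =
  trans (cong (f lo +_) (trans (sumFrom-split f (suc lo) j k)
                               (cong (λ i → sumFrom f (suc lo) j + sumFrom f i k) (sym (+-suc lo j)))))
        (sym (+-assoc (f lo) (sumFrom f (suc lo) j) (sumFrom f (lo + suc j) k)))

sumFrom-+ : ∀ f g lo k → sumFrom (λ i → f i + g i) lo k ≡ sumFrom f lo k + sumFrom g lo k
sumFrom-+ f g lo zero    = refl
sumFrom-+ f g lo (suc k) =
  trans (cong (f lo + g lo +_) (sumFrom-+ f g (suc lo) k))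
        (interchange +-commutativeSemigroup (f lo) (g lo) (sumFrom f (suc lo) k) (sumFrom g (suc lo) k))

sumFrom-shift : ∀ f lo k → sumFrom (λ i → f (suc i)) lo k ≡ sumFrom f (suc lo) k
sumFrom-shift f lo zero    = refl
sumFrom-shift f lo (suc k) = cong (f (suc lo) +_) (sumFrom-shift f (suc lo) k)

sumFrom-≤ : ∀ f lo k → (∀ i → lo ≤ i → i < lo + k → f i ≤ 1) → sumFrom f lo k ≤ k
sumFrom-≤ f lo zero    p = z≤n
sumFrom-≤ f lo (suc k) p = +-mono-≤
  (p lo ≤-refl (m<m+n lo (s≤s z≤n)))
  (sumFrom-≤ f (suc lo) k λ i lo<i i< → p i (<⇒≤ lo<i) (subst (i <_) (sym (+-suc lo k)) i<))

walk-source : ∀ {n} {G : Graph n} {A : Fin n → Set} {u w} → Walk G A u w → A u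
walk-source (here Au)     = Au
walk-source (step Au _ _) = Au

sumFrom-+₃ : ∀ f g h lo k →
             sumFrom (λ i → f i + g i + h i) lo k ≡ sumFrom f lo k + sumFrom g lo k + sumFrom h lo k
sumFrom-+₃ f g h lo k =
  trans (sumFrom-+ (λ i → f i + g i) h lo k) (cong (_+ sumFrom h lo k) (sumFrom-+ f g lo k))

sumFrom-last : ∀ f lo k → sumFrom f lo (suc k) ≡ sumFrom f lo k + f (lo + k)
sumFrom-last f lo k =
  trans (cong (sumFrom f lo) (+-comm 1 k)) (trans (sumFrom-split f lo k 1) (cong (sumFrom f lo k +_) (+-identityʳ _)))

-- Column z of the count holds f (z + 1), w z and g (z - 1), with x in place of g (lo - 1);
-- each column contributes at most 1, except that the first may contribute 2.
columns-≤ : ∀ f w g x lo s → (∀ i → f i ≤ 1) → w lo + x ≤ 1 →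
            (∀ j → lo ≤ j → suc j < lo + s → f (2 + j) + w (1 + j) + g j ≤ 1) →
            (∀ j → lo ≤ j → suc j ≡ lo + s → w (suc j) + g j ≤ 1) →
            sumFrom f (suc lo) s + sumFrom w lo (suc s) + sumFrom g lo s + x ≤ s + 2
columns-≤ f w g x lo zero    f≤1 first middle last =
  lin 2 (λ w x → w ⊕ x ≼ # 1 ∷ [] ⊢ w ⊕ # 0 ⊕ # 0 ⊕ x ≼ # 2) (w lo ∷ x ∷ []) first
columns-≤ f w g x lo (suc s) f≤1 first middle last =
  lin 11 (λ f₁ F w₀ W wl G gl x s W′ G′ →
      f₁ ≼ # 1 ∷ w₀ ⊕ x ≼ # 1 ∷ F ⊕ W ⊕ G ≼ s ∷ wl ⊕ gl ≼ # 1 ∷ W′ ≈ W ⊕ wl ∷ G′ ≈ G ⊕ gl ∷ [] ⊢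
      f₁ ⊕ F ⊕ (w₀ ⊕ W′) ⊕ G′ ⊕ x ≼ # 1 ⊕ s ⊕ # 2)
    (f (suc lo) ∷ sumFrom f (2 + lo) s ∷ w lo ∷ sumFrom w (suc lo) s ∷ w (suc lo + s) ∷
      sumFrom g lo s ∷ g (lo + s) ∷ x ∷ s ∷ sumFrom w (suc lo) (suc s) ∷ sumFrom g lo (suc s) ∷ [])
    (f≤1 (suc lo)) first
    (subst (_≤ s) shifted (sumFrom-≤ (λ j → f (2 + j) + w (1 + j) + g j) lo s λ j p q →
      middle j p (subst (suc j <_) (sym (+-suc lo s)) (s≤s q))))
    (last (lo + s) (m≤m+n lo s) (sym (+-suc lo s)))
    (sumFrom-last w (suc lo) s) (sumFrom-last g lo s)
  where
  shifted : sumFrom (λ j → f (2 + j) + w (1 + j) + g j) lo s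
            ≡ sumFrom f (2 + lo) s + sumFrom w (suc lo) s + sumFrom g lo s
  shifted = trans (sumFrom-+₃ (λ j → f (2 + j)) (w ∘ suc) g lo s)
    (cong (_+ sumFrom g lo s)
      (cong₂ _+_ (trans (sumFrom-shift (f ∘ suc) lo s) (sumFrom-shift f (suc lo) s)) (sumFrom-shift w lo s)))

-- Paths

module Routes {n : ℕ} (G : Graph n) where

  adj-sym : ∀ {u v} → Adj G u v → Adj G v u
  adj-sym {u} {v} = subst T (Graph.sym G u v)

  adj-irrefl : ∀ {u} → ¬ Adj G u u
  adj-irrefl {u} p with adj G u u | irrefl G u
  adj-irrefl () | false | _

  degree-≤-filter : ∀ u ys → (∀ t → Adj G u t → t ∈ ys) → degree G u ≤ length (filterᵇ (adj G u) ys)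
  degree-≤-filter u ys covers = unique-⊆-length
    (Unique.filter⁺ (T? ∘ adj G u) (Unique.allFin⁺ n))
    (λ {t} t∈ → let _ , u~t = ∈-filter⁻ (T? ∘ adj G u) {xs = allFin n} t∈ in
                ∈-filter⁺ (T? ∘ adj G u) (covers t u~t) u~t)

  degree-≤-length : ∀ u ys → (∀ t → Adj G u t → t ∈ ys) → degree G u ≤ length ys
  degree-≤-length u ys covers = unique-⊆-length
    (Unique.filter⁺ (T? ∘ adj G u) (Unique.allFin⁺ n))
    (λ {t} t∈ → covers t (proj₂ (∈-filter⁻ (T? ∘ adj G u) {xs = allFin n} t∈)))

  -- Unlike `Chain`, this carries both ends in its type, which makes concatenation and reversal easy
  -- to state.
  data Trail : Fin n → Fin n → List (Fin n) → Set where
    stop : ∀ {x} → Trail x x [ x ]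
    _◂_  : ∀ {x y z xs} → Adj G x y → Trail y z xs → Trail x z (x ∷ xs)

  trail-++ : ∀ {x y z w xs ys} → Trail x y xs → Adj G y z → Trail z w ys → Trail x w (xs ++ ys)
  trail-++ stop    y~z s = y~z ◂ s
  trail-++ (a ◂ t) y~z s = a ◂ trail-++ t y~z s

  trail-reverse : ∀ {x y xs} → Trail x y xs → Trail y x (reverse xs)
  trail-reverse stop = stop
  trail-reverse {x} (_◂_ {xs = xs} a t) =
    subst (Trail _ _) (sym (unfold-reverse x xs)) (trail-++ (trail-reverse t) (adj-sym a) stop)

  trail⇒chain : ∀ {x y xs} → Trail x y xs → Chain G xs
  trail⇒chain stop          = one _
  trail⇒chain (a ◂ stop)    = cons a (one _)
  trail⇒chain (a ◂ (b ◂ t)) = cons a (trail⇒chain (b ◂ t))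

  chain⇒trail : ∀ {x xs} → Chain G (x ∷ xs) → ∃ λ y → Trail x y (x ∷ xs)
  chain⇒trail (one x)    = x , stop
  chain⇒trail (cons a c) = let y , t = chain⇒trail c in y , a ◂ t

  trail-nth-0 : ∀ {d x y xs} → Trail x y xs → nth d xs 0 ≡ x
  trail-nth-0 stop    = refl
  trail-nth-0 (_ ◂ _) = refl

  trail-nth-last : ∀ {d x y xs k} → Trail x y xs → length xs ≡ suc k → nth d xs k ≡ y
  trail-nth-last {k = zero}  stop           refl = refl
  trail-nth-last {k = suc k} (_ ◂ t)        eq   = trail-nth-last t (suc-injective eq)
  trail-nth-last {k = zero}  (_ ◂ stop)     ()
  trail-nth-last {k = zero}  (_ ◂ (_ ◂ _))  ()

  trail-nth-step : ∀ {d x y xs i} → Trail x y xs → suc i < length xs → Adj G (nth d xs i) (nth d xs (suc i))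
  trail-nth-step stop (s≤s ())
  trail-nth-step {i = zero}  (a ◂ t) p = subst (Adj G _) (sym (trail-nth-0 t)) a
  trail-nth-step {i = suc i} (a ◂ t) (s≤s p) = trail-nth-step t p

  -- A path with ℓ vertices. The predicate `Q` contains its vertex set, possibly strictly, so that
  -- disjointness of two routes is argued from their predicates and not from their lists.
  record Route (x y : Fin n) (Q : Fin n → Set) (ℓ : ℕ) : Set where
    constructor route
    field
      list   : List (Fin n)
      trail  : Trail x y list
      unique : Unique list
      within : ∀ {t} → t ∈ list → Q t
      size   : length list ≡ ℓ
  open Route public

  join : ∀ {x y z w Q Q′ k l} → Route x y Q k → Adj G y z → Route z w Q′ l →
         (∀ {t} → Q t → Q′ t → ⊥) → Route x w (λ t → Q t ⊎ Q′ t) (k + l)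
  list   (join r a s dis) = list r ++ list s
  trail  (join r a s dis) = trail-++ (trail r) a (trail s)
  unique (join r a s dis) = Unique.++⁺ (unique r) (unique s) (λ (p , q) → dis (within r p) (within s q))
  within (join r a s dis) t∈ with ∈-++⁻ (list r) t∈
  ... | inj₁ p = inj₁ (within r p)
  ... | inj₂ q = inj₂ (within s q)
  size   (join r a s dis) = trans (length-++ (list r)) (cong₂ _+_ (size r) (size s))

  join₃ : ∀ {x₁ y₁ x₂ y₂ x₃ y₃ Q₁ Q₂ Q₃ k₁ k₂ k₃} →
          Route x₁ y₁ Q₁ k₁ → Adj G y₁ x₂ → Route x₂ y₂ Q₂ k₂ → Adj G y₂ x₃ → Route x₃ y₃ Q₃ k₃ →
          (∀ {t} → Q₁ t → Q₂ t → ⊥) → (∀ {t} → Q₁ t → Q₃ t → ⊥) → (∀ {t} → Q₂ t → Q₃ t → ⊥) →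
          Route x₁ y₃ (λ t → Q₁ t ⊎ Q₂ t ⊎ Q₃ t) (k₁ + (k₂ + k₃))
  join₃ r a s b t d₁₂ d₁₃ d₂₃ = join r a (join s b t d₂₃) λ { p (inj₁ q) → d₁₂ p q ; p (inj₂ q) → d₁₃ p q }

  join₄ : ∀ {x₁ y₁ x₂ y₂ x₃ y₃ x₄ y₄ Q₁ Q₂ Q₃ Q₄ k₁ k₂ k₃ k₄} →
          Route x₁ y₁ Q₁ k₁ → Adj G y₁ x₂ → Route x₂ y₂ Q₂ k₂ → Adj G y₂ x₃ →
          Route x₃ y₃ Q₃ k₃ → Adj G y₃ x₄ → Route x₄ y₄ Q₄ k₄ →
          (∀ {t} → Q₁ t → Q₂ t → ⊥) → (∀ {t} → Q₁ t → Q₃ t → ⊥) → (∀ {t} → Q₁ t → Q₄ t → ⊥) →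
          (∀ {t} → Q₂ t → Q₃ t → ⊥) → (∀ {t} → Q₂ t → Q₄ t → ⊥) → (∀ {t} → Q₃ t → Q₄ t → ⊥) →
          Route x₁ y₄ (λ t → Q₁ t ⊎ Q₂ t ⊎ Q₃ t ⊎ Q₄ t) (k₁ + (k₂ + (k₃ + k₄)))
  join₄ r a s b t c u d₁₂ d₁₃ d₁₄ d₂₃ d₂₄ d₃₄ =
    join r a (join₃ s b t c u d₂₃ d₂₄ d₃₄)
      λ { p (inj₁ q) → d₁₂ p q ; p (inj₂ (inj₁ q)) → d₁₃ p q ; p (inj₂ (inj₂ q)) → d₁₄ p q }

  point : ∀ x → Route x x (_≡ x) 1
  point x = route [ x ] stop ([] ∷ []) (λ { (here refl) → refl }) refl

  private
    unique-reverse : ∀ {xs : List (Fin n)} → Unique xs → Unique (reverse xs)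
    unique-reverse []                     = []
    unique-reverse {x ∷ xs} (x∉ ∷ u) = subst Unique (sym (unfold-reverse x xs))
      (Unique.++⁺ (unique-reverse u) ([] ∷ []) λ { (p , here refl) → All.lookup x∉ (Any.reverse⁻ p) refl })

  backwards : ∀ {x y Q k} → Route x y Q k → Route y x Q k
  backwards r = route (reverse (list r)) (trail-reverse (trail r)) (unique-reverse (unique r))
                  (λ t∈ → within r (Any.reverse⁻ t∈)) (trans (length-reverse (list r)) (size r))

  widen : ∀ {x y Q Q′ k} → (∀ {t} → Q t → Q′ t) → Route x y Q k → Route x y Q′ k
  widen Q⊆ r = route (list r) (trail r) (unique r) (Q⊆ ∘ within r) (size r)

  resize : ∀ {x y Q k l} → k ≡ l → Route x y Q k → Route x y Q l
  resize eq r = route (list r) (trail r) (unique r) (within r) (trans (size r) eq)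

  -- The path v 0, ..., v L with L + 1 vertices. The values of `v` beyond L are arbitrary.
  record PathOn (v : ℕ → Fin n) (L : ℕ) : Set where
    field
      injective : ∀ {i j} → i ≤ L → j ≤ L → v i ≡ v j → i ≡ j
      edge      : ∀ {i} → i < L → Adj G (v i) (v (suc i))

  route⇒pathOn : ∀ {x y Q L} d (r : Route x y Q (suc L)) → PathOn (nth d (list r)) L
  PathOn.injective (route⇒pathOn d r) p q =
    nth-injective (unique r) (subst (_ <_) (sym (size r)) (s≤s p)) (subst (_ <_) (sym (size r)) (s≤s q))
  PathOn.edge (route⇒pathOn d r) p = trail-nth-step (trail r) (subst (_ <_) (sym (size r)) (s≤s p))

  module Segments {v : ℕ → Fin n} {L : ℕ} (P : PathOn v L) where
    open PathOn P public

    In : ℕ → ℕ → Fin n → Set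
    In lo hi t = ∃ λ i → lo ≤ i × i ≤ hi × t ≡ v i

    in-subset : ∀ {lo hi lo′ hi′ t} → lo′ ≤ lo → hi ≤ hi′ → In lo hi t → In lo′ hi′ t
    in-subset p q (i , a , b , eq) = i , ≤-trans p a , ≤-trans b q , eq

    in-disjoint : ∀ {lo hi lo′ hi′ t} → hi < lo′ → hi′ ≤ L → In lo hi t → In lo′ hi′ t → ⊥
    in-disjoint hi<lo′ hi′≤L (i , a , b , refl) (j , c , d , eq) =
      <⇒≢ (≤-trans (s≤s b) (≤-trans hi<lo′ c))
        (injective (≤-trans b (≤-trans (<⇒≤ hi<lo′) (≤-trans c (≤-trans d hi′≤L)))) (≤-trans d hi′≤L) eq)

    in-disjoint′ : ∀ {lo hi lo′ hi′ t} → hi < lo′ → hi′ ≤ L → In lo′ hi′ t → In lo hi t → ⊥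
    in-disjoint′ p q a b = in-disjoint p q b a

    segment : ℕ → ℕ → List (Fin n)
    segment lo zero    = []
    segment lo (suc k) = v lo ∷ segment (suc lo) k

    length-segment : ∀ lo k → length (segment lo k) ≡ k
    length-segment lo zero    = refl
    length-segment lo (suc k) = cong suc (length-segment (suc lo) k)

    ∈-segment : ∀ lo k {i} → lo ≤ i → i < lo + k → v i ∈ segment lo k
    ∈-segment lo zero    p q = ⊥-elim (<⇒≱ q (≤-trans (≤-reflexive (+-identityʳ lo)) p))
    ∈-segment lo (suc k) {i} p q with m≤n⇒m<n∨m≡n p
    ... | inj₁ lo<i = there (∈-segment (suc lo) k lo<i (subst (i <_) (+-suc lo k) q))
    ... | inj₂ refl = here refl

    segment-∈ : ∀ lo k {t} → t ∈ segment lo (suc k) → In lo (lo + k) t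
    segment-∈ lo k (here refl) = lo , ≤-refl , m≤m+n lo k , refl
    segment-∈ lo (suc k) (there t∈) with segment-∈ (suc lo) k t∈
    ... | i , a , b , eq = i , <⇒≤ a , subst (i ≤_) (sym (+-suc lo k)) b , eq

    segment-trail : ∀ lo k → lo + k ≤ L → Trail (v lo) (v (lo + k)) (segment lo (suc k))
    segment-trail lo zero    p = subst (λ j → Trail (v lo) (v j) (segment lo 1)) (sym (+-identityʳ lo)) stop
    segment-trail lo (suc k) p = subst (λ j → Trail (v lo) (v j) (segment lo (suc (suc k)))) (sym (+-suc lo k))
      (edge (≤-trans (≤-trans (m≤m+n (suc lo) k) (≤-reflexive (sym (+-suc lo k)))) p)
        ◂ segment-trail (suc lo) k (≤-trans (≤-reflexive (sym (+-suc lo k))) p))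

    segment-unique : ∀ lo k → lo + k ≤ L → Unique (segment lo (suc k))
    segment-unique lo zero    p = [] ∷ []
    segment-unique lo (suc k) p =
      All.tabulate (λ t∈ eq → in-disjoint {lo} {lo} ≤-refl (≤-trans (≤-reflexive (sym (+-suc lo k))) p)
        (lo , ≤-refl , ≤-refl , refl) (subst (In _ _) (sym eq) (segment-∈ (suc lo) k t∈)))
      ∷ segment-unique (suc lo) k (≤-trans (≤-reflexive (sym (+-suc lo k))) p)

    up : ∀ {lo hi} → lo ≤ hi → hi ≤ L → Route (v lo) (v hi) (In lo hi) (suc (hi ∸ lo))
    up {lo} {hi} p q = route (segment lo (suc (hi ∸ lo)))
      (subst (λ j → Trail (v lo) (v j) (segment lo (suc (hi ∸ lo)))) eq (segment-trail lo (hi ∸ lo) hi≤L))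
      (segment-unique lo (hi ∸ lo) hi≤L)
      (λ t∈ → subst (λ j → In lo j _) eq (segment-∈ lo (hi ∸ lo) t∈))
      (length-segment lo _)
      where
      eq : lo + (hi ∸ lo) ≡ hi
      eq = m+[n∸m]≡n p
      hi≤L : lo + (hi ∸ lo) ≤ L
      hi≤L = ≤-trans (≤-reflexive eq) q

    down : ∀ {lo hi} → lo ≤ hi → hi ≤ L → Route (v hi) (v lo) (In lo hi) (suc (hi ∸ lo))
    down p q = backwards (up p q)

    neighbour : Fin n → ℕ → ℕ
    neighbour u i = indicator (adj G u (v i))

    filter-segment : ∀ u lo k → length (filterᵇ (adj G u) (segment lo k)) ≡ sumFrom (neighbour u) lo k
    filter-segment u lo zero    = refl
    filter-segment u lo (suc k) with adj G u (v lo)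
    ... | true  = cong suc (filter-segment u (suc lo) k)
    ... | false = filter-segment u (suc lo) k

    degree-≤-sum : ∀ {u lo hi} k → lo + k ≡ suc hi → (∀ {t} → Adj G u t → In lo hi t) →
                   degree G u ≤ sumFrom (neighbour u) lo k
    degree-≤-sum {u} {lo} {hi} k eq inside = subst (degree G u ≤_) (filter-segment u lo k)
      (degree-≤-filter u (segment lo k) λ t a → located (inside a))
      where
      located : ∀ {t} → In lo hi t → t ∈ segment lo k
      located (i , p , q , refl) = ∈-segment lo k p (subst (i <_) (sym eq) (s≤s q))

-- Closing routes to cycles, and ends of longest paths

module Longest {n : ℕ} (G : Graph n) (L c : ℕ)
  (longest : ∀ xs → IsPath G xs → length xs ≤ suc L)
  (cycle-≤ : ∀ xs → IsCycle G xs → length xs ≤ c) (3≤c : 3 ≤ c) where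

  open Routes G public
  open DecMembership (Fin._≟_ {n}) using (_∈?_)

  closed : ∀ {x y Q ℓ} → Route x y Q ℓ → Adj G y x → ℓ ≤ c
  closed {ℓ = ℓ} r a with ℓ ≤? 3
  -- A route with fewer than three vertices does not close to a cycle; for such short routes c ≥ 3
  -- suffices.
  ... | yes ℓ≤3 = ≤-trans ℓ≤3 3≤c
  ... | no  ℓ≰3 = subst (_≤ c) (size r)
    (cycle-≤ (list r) (isCycle (trail r) (unique r) a (subst (3 ≤_) (sym (size r)) (<⇒≤ (≰⇒> ℓ≰3)))))
    where
    isCycle : ∀ {x y xs} → Trail x y xs → Unique xs → Adj G y x → 3 ≤ length xs → IsCycle G xs
    isCycle stop    u a 3≤ = 3≤ , u , trail⇒chain (trail-++ stop a stop)
    isCycle (b ◂ t) u a 3≤ = 3≤ , u , trail⇒chain (trail-++ (b ◂ t) a stop)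

  -- A neighbour of the first vertex outside the route could be prepended, giving a path with L + 2
  -- vertices.
  endpoint-∈ : ∀ {x y Q t} (r : Route x y Q (suc L)) → Adj G x t → t ∈ list r
  endpoint-∈ {t = t} r a with t ∈? list r
  ... | yes t∈ = t∈
  ... | no  t∉ = ⊥-elim (<⇒≱ (s≤s (≤-reflexive (sym (size r)))) (longest (t ∷ list r) (extended , chain)))
    where
    extended = All.tabulate (λ s∈ eq → t∉ (subst (_∈ list r) (sym eq) s∈)) ∷ unique r
    chain    = trail⇒chain (adj-sym a ◂ trail r)

  endpoint : ∀ {x y Q t} → Route x y Q (suc L) → Adj G x t → Q t
  endpoint r a = within r (endpoint-∈ r a)

  -- Lollipops

  -- The cycle is v 0, ..., v e, and the tail is the rest of a longest path. For e = 1 the cycle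
  -- degenerates to an edge, so a lollipop exists as soon as L > 0.
  record Lollipop (e : ℕ) : Set where
    constructor lollipop
    field
      vertex : ℕ → Fin n
      path   : PathOn vertex L
      e≤L    : e ≤ L
      chord  : Adj G (vertex 0) (vertex e)

  module Extremal (e : ℕ) (maximal : ∀ j → Lollipop j → j ≤ e) where

    -- A neighbour further along the path would give a lollipop with a longer cycle.
    start-neighbours : ∀ {x y z w Q Q′ k t} → Route x y Q (suc e) → Adj G y z → Route z w Q′ k →
                       (∀ {t} → Q t → Q′ t → ⊥) → suc e + k ≡ suc L → Adj G x t → Q t
    start-neighbours {x} {k = k} {t = t} r a s dis eq x~t
      with ∈-++⁻ (list r) (endpoint-∈ (resize eq (join r a s dis)) x~t)
    ... | inj₁ t∈ = within r t∈
    ... | inj₂ t∈ with ∈-nth {d = x} t∈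
    ... | i , i< , nth≡t = ⊥-elim (m+n≮m e i (maximal (suc e + i) found))
      where
      whole = resize eq (join r a s dis)
      at : nth x (list r ++ list s) (suc e + i) ≡ t
      at = trans (cong (λ l → nth x (list r ++ list s) (l + i)) (sym (size r))) (trans (nth-++ʳ (list r)) nth≡t)
      found : Lollipop (suc e + i)
      found = lollipop (nth x (list whole)) (route⇒pathOn x whole)
        (lin 4 (λ e i k L → i ≺ k ∷ # 1 ⊕ e ⊕ k ≈ # 1 ⊕ L ∷ [] ⊢ # 1 ⊕ e ⊕ i ≼ L) (e ∷ i ∷ k ∷ L ∷ [])
          (subst (i <_) (size s) i<) eq)
        (subst (Adj G _) (sym at) (subst (λ u → Adj G u t) (sym (trail-nth-0 (trail whole))) x~t))

  -- Ore's argument on the cycle of a maximal lollipop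

  module MaximalLollipop (e : ℕ) (maximal : ∀ j → Lollipop j → j ≤ e)
    {v : ℕ → Fin n} (P : PathOn v L) (e<L : e < L) (chord : Adj G (v 0) (v e)) where

    open Extremal e maximal public
    open Segments P public

    -- The end v e is where the tail is attached. Such a route followed by the tail is a longest
    -- path from v k, so maximality of e confines the neighbours of v k to the cycle.
    Hamiltonian : ℕ → Set
    Hamiltonian k = Route (v k) (v e) (In 0 e) (suc e)

    hamiltonian-neighbours : ∀ {k t} → Hamiltonian k → Adj G (v k) t → In 0 e t
    hamiltonian-neighbours h = start-neighbours h (edge e<L) (up e<L ≤-refl) (in-disjoint ≤-refl ≤-refl)
      (cong suc (trans (+-suc e (L ∸ suc e)) (m+[n∸m]≡n e<L)))

    hamiltonian-0 : Hamiltonian 0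
    hamiltonian-0 = up z≤n (<⇒≤ e<L)

    hamiltonian-last : ∀ {k} → suc k ≡ e → Hamiltonian k
    hamiltonian-last {k} refl = resize (+-comm (suc k) 1) (widen inside
      (join (down z≤n (≤-trans (n≤1+n k) (<⇒≤ e<L))) chord (point (v e))
        λ { p refl → in-disjoint {lo′ = suc k} ≤-refl (<⇒≤ e<L) p (e , ≤-refl , ≤-refl , refl) }))
      where
      inside : ∀ {t} → In 0 k t ⊎ t ≡ v e → In 0 e t
      inside (inj₁ p)    = in-subset z≤n (n≤1+n k) p
      inside (inj₂ refl) = e , z≤n , ≤-refl , refl

    module _ {k i : ℕ} (i<k : i < k) (k+1<e : suc k < e) where
      -- The route runs from v k down to v (i + 1), across to v 0, up to v i, across to v (k + 1)
      -- and up to v e.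
      hamiltonian-low : Adj G (v (suc k)) (v i) → Adj G (v 0) (v (suc i)) → Hamiltonian k
      hamiltonian-low a b = resize
        (lin 5 (λ e k i A B → # 1 ⊕ i ⊕ A ≈ k ∷ # 1 ⊕ k ⊕ B ≈ e ∷ [] ⊢
            (# 1 ⊕ A) ⊕ ((# 1 ⊕ i) ⊕ (# 1 ⊕ B)) ≈ # 1 ⊕ e)
          (e ∷ k ∷ i ∷ k ∸ suc i ∷ e ∸ suc k ∷ []) (m+[n∸m]≡n i<k) (m+[n∸m]≡n k<e))
        (widen (λ { (inj₁ p)        → in-subset z≤n (<⇒≤ k<e) p
                  ; (inj₂ (inj₁ p)) → in-subset z≤n (≤-trans (<⇒≤ i<k) (<⇒≤ k<e)) p
                  ; (inj₂ (inj₂ p)) → in-subset z≤n ≤-refl p })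
          (join₃ (down i<k k≤L) (adj-sym b) (up {0} {i} z≤n (≤-trans (<⇒≤ i<k) k≤L)) (adj-sym a) (up k<e (<⇒≤ e<L))
            (in-disjoint′ ≤-refl k≤L) (in-disjoint ≤-refl (<⇒≤ e<L))
            (in-disjoint (m<n⇒m<1+n i<k) (<⇒≤ e<L))))
        where
        k<e = <⇒≤ k+1<e
        k≤L = ≤-trans (<⇒≤ k<e) (<⇒≤ e<L)

    module _ {k i : ℕ} (k<i : k < i) (i<e : i < e) where
      -- The route runs from v k down to v 0, across to v i, down to v (k + 1), across to v (i + 1)
      -- and up to v e.
      hamiltonian-high : Adj G (v 0) (v i) → Adj G (v (suc k)) (v (suc i)) → Hamiltonian k
      hamiltonian-high a b = resize
        (lin 5 (λ e k i A B → # 1 ⊕ k ⊕ A ≈ i ∷ # 1 ⊕ i ⊕ B ≈ e ∷ [] ⊢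
            (# 1 ⊕ k) ⊕ ((# 1 ⊕ A) ⊕ (# 1 ⊕ B)) ≈ # 1 ⊕ e)
          (e ∷ k ∷ i ∷ i ∸ suc k ∷ e ∸ suc i ∷ []) (m+[n∸m]≡n k<i) (m+[n∸m]≡n i<e))
        (widen (λ { (inj₁ p)        → in-subset z≤n (≤-trans (<⇒≤ k<i) (<⇒≤ i<e)) p
                  ; (inj₂ (inj₁ p)) → in-subset z≤n (<⇒≤ i<e) p
                  ; (inj₂ (inj₂ p)) → in-subset z≤n ≤-refl p })
          (join₃ (down {0} {k} z≤n (≤-trans (<⇒≤ k<i) i≤L)) a (down k<i i≤L) b (up i<e (<⇒≤ e<L))
            (in-disjoint ≤-refl i≤L) (in-disjoint (m<n⇒m<1+n k<i) (<⇒≤ e<L))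
            (in-disjoint ≤-refl (<⇒≤ e<L))))
        where
        i≤L = ≤-trans (<⇒≤ i<e) (<⇒≤ e<L)

    -- Ore's argument: otherwise the neighbours of v 0 and v (k + 1) in v 0, …, v e
    -- have no such pair, and the two degrees add up to at most e + 1.
    hamiltonian-pred : ∀ {k δ} → (∀ u → δ ≤ degree G u) → suc e < 2 * δ → suc k < e →
                       Hamiltonian (suc k) → (Hamiltonian k → ⊥) → ⊥
    hamiltonian-pred {k} {δ} δ≤ e<2δ k+1<e h none = <⇒≱ e<2δ
      (lin 12 (λ δ e k m d₀ d₁ F₁ F₂ fe gk G₁ G₂ →
          δ ≼ d₀ ∷ δ ≼ d₁ ∷ d₀ ≼ F₁ ⊕ (F₂ ⊕ (fe ⊕ # 0)) ∷ d₁ ≼ G₁ ⊕ (gk ⊕ G₂) ∷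
          fe ≼ # 1 ∷ gk ≼ # 1 ∷ F₁ ⊕ G₁ ≼ k ∷ F₂ ⊕ G₂ ≼ # 1 ⊕ m ∷ # 2 ⊕ k ⊕ m ≈ e ∷ [] ⊢ 2 ⊗ δ ≼ # 1 ⊕ e)
        (δ ∷ e ∷ k ∷ m ∷ degree G (v 0) ∷ degree G (v (suc k)) ∷ sumFrom f 1 k ∷ sumFrom f (suc k) (suc m) ∷
          f (suc k + suc m) ∷ g k ∷ sumFrom g 0 k ∷ sumFrom g (suc (suc k)) (suc m) ∷ [])
        (δ≤ (v 0)) (δ≤ (v (suc k))) f-sum g-sum (indicator-≤1 (adj G (v 0) (v (suc k + suc m))))
        (indicator-≤1 (adj G (v (suc k)) (v k))) low high (m+[n∸m]≡n k+1<e))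
      where
      m = e ∸ suc (suc k)
      f = neighbour (v 0)
      g = neighbour (v (suc k))
      -- Position `suc k + suc m` is e. The terms `f e` and `g k` are in neither `low` nor `high`;
      -- with them the total is at most k + (m + 1) + 2 = e + 1.
      f-sum : degree G (v 0) ≤ sumFrom f 1 k + (sumFrom f (suc k) (suc m) + (f (suc k + suc m) + 0))
      f-sum = ≤-trans
        (degree-≤-sum (suc (k + (suc m + 1)))
          (lin 3 (λ e k m → # 2 ⊕ k ⊕ m ≈ e ∷ [] ⊢ # 1 ⊕ (k ⊕ (# 1 ⊕ m ⊕ # 1)) ≈ # 1 ⊕ e) (e ∷ k ∷ m ∷ [])
            (m+[n∸m]≡n k+1<e))
          (hamiltonian-neighbours hamiltonian-0))
        (≤-reflexive (trans (cong (_+ sumFrom f 1 (k + (suc m + 1))) (indicator-¬ _ adj-irrefl))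
          (trans (sumFrom-split f 1 k (suc m + 1)) (cong (sumFrom f 1 k +_) (sumFrom-split f (suc k) (suc m) 1)))))
      g-sum : degree G (v (suc k)) ≤ sumFrom g 0 k + (g k + sumFrom g (suc (suc k)) (suc m))
      g-sum = ≤-trans
        (degree-≤-sum (k + suc (suc (suc m)))
          (lin 3 (λ e k m → # 2 ⊕ k ⊕ m ≈ e ∷ [] ⊢ k ⊕ (# 3 ⊕ m) ≈ # 1 ⊕ e) (e ∷ k ∷ m ∷ []) (m+[n∸m]≡n k+1<e))
          (hamiltonian-neighbours h))
        (≤-reflexive (trans (sumFrom-split g 0 k (suc (suc (suc m))))
          (cong (λ z → sumFrom g 0 k + (g k + (z + sumFrom g (suc (suc k)) (suc m)))) (indicator-¬ _ adj-irrefl))))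
      low : sumFrom f 1 k + sumFrom g 0 k ≤ k
      low = subst (_≤ k)
        (trans (sumFrom-+ (f ∘ suc) g 0 k) (cong (_+ sumFrom g 0 k) (sumFrom-shift f 0 k)))
        (sumFrom-≤ (λ i → f (suc i) + g i) 0 k λ i _ i<k →
          exclusive₂ (adj G (v 0) (v (suc i))) (adj G (v (suc k)) (v i)) λ a b → none (hamiltonian-low i<k k+1<e b a))
      high : sumFrom f (suc k) (suc m) + sumFrom g (suc (suc k)) (suc m) ≤ suc m
      high = subst (_≤ suc m)
        (trans (sumFrom-+ f (g ∘ suc) (suc k) (suc m)) (cong (sumFrom f (suc k) (suc m) +_) (sumFrom-shift g (suc k) (suc m))))
        (sumFrom-≤ (λ i → f i + g (suc i)) (suc k) (suc m) λ i k<i i< →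
          exclusive₂ (adj G (v 0) (v i)) (adj G (v (suc k)) (v (suc i))) λ a b → none (hamiltonian-high k<i
            (lin 4 (λ e k m i → # 2 ⊕ k ⊕ m ≈ e ∷ i ≺ # 1 ⊕ k ⊕ (# 1 ⊕ m) ∷ [] ⊢ i ≺ e) (e ∷ k ∷ m ∷ i ∷ [])
              (m+[n∸m]≡n k+1<e) i<) a b))

    -- Downward induction from k = e - 1, where the route goes down to v 0 and across the chord; `j`
    -- counts the remaining steps.
    hamiltonian-all : ∀ {δ} → (∀ u → δ ≤ degree G u) → suc e < 2 * δ →
                      ∀ j {k} → suc (k + j) ≡ e → (Hamiltonian k → ⊥) → ⊥
    hamiltonian-all δ≤ e<2δ zero    {k} eq none = none (hamiltonian-last (trans (cong suc (sym (+-identityʳ k))) eq))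
    hamiltonian-all δ≤ e<2δ (suc j) {k} eq none = hamiltonian-all δ≤ e<2δ j {suc k}
      (trans (cong suc (sym (+-suc k j))) eq)
      λ h → hamiltonian-pred δ≤ e<2δ (subst (suc k <_) eq (s≤s (m<m+n k (s≤s z≤n)))) h none

    -- Otherwise every v k with k < e has all its neighbours on the cycle. A walk from v 0 to v (e +
    -- 1) that avoids v e then never leaves v 0, ..., v (e - 1).
    2δ≤e+1 : ∀ {δ} → (∀ u → δ ≤ degree G u) → TwoConnected G → 2 * δ ≤ suc e
    2δ≤e+1 {δ} δ≤ (_ , _ , connected) with 2 * δ ≤? suc e
    ... | yes p = p
    ... | no ¬p = ⊥-elim (stays 0<e refl (connected (v e) (v 0) (v (suc e))
                    (λ eq → <⇒≢ 0<e (injective z≤n (<⇒≤ e<L) eq))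
                    (λ eq → <⇒≢ ≤-refl (sym (injective e<L (<⇒≤ e<L) eq)))))
      where
      0<e : 0 < e
      0<e = n≢0⇒n>0 λ { refl → adj-irrefl chord }
      stays : ∀ {k u} → k < e → u ≡ v k → Walk G (_≢ v e) u (v (suc e)) → ⊥
      stays {k} k<e eq (here _) = <⇒≢ (m<n⇒m<1+n k<e) (sym (injective e<L (≤-trans (<⇒≤ k<e) (<⇒≤ e<L)) eq))
      stays {k} k<e refl (step {w = w} _ a walk) = hamiltonian-all δ≤ (≰⇒> ¬p) (e ∸ suc k) (m+[n∸m]≡n k<e)
        λ h → next (hamiltonian-neighbours h a)
        where
        next : In 0 e w → ⊥
        next (i , _ , i≤e , eq) = stays (≤∧≢⇒< i≤e λ { refl → walk-source walk eq }) eq walk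

  -- Counting three degrees around the cycle when v (e + 1) has a second neighbour v a there

  module Attached (e : ℕ) (maximal : ∀ j → Lollipop j → j ≤ e)
    {v : ℕ → Fin n} (P : PathOn v L) (e<L : e < L) (chord : Adj G (v 0) (v e))
    (c<L : c < L) {a : ℕ} (a<e : a < e) (attach : Adj G (v (suc e)) (v a)) where

    open MaximalLollipop e maximal P e<L chord

    e≤L : e ≤ L
    e≤L = <⇒≤ e<L

    a≤L : a ≤ L
    a≤L = ≤-trans (<⇒≤ a<e) e≤L

    beyond : In 0 e (v (suc e)) → ⊥
    beyond p = in-disjoint {lo′ = suc e} ≤-refl e<L p (suc e , ≤-refl , ≤-refl , refl)

    ¬hamiltonian : Hamiltonian a → ⊥
    ¬hamiltonian h = beyond (hamiltonian-neighbours h (adj-sym attach))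

    -- The path v (a + 1), ..., v e, v 0, ..., v a, v (e + 1), ..., v L is again longest, and its
    -- first e + 1 vertices are those of the cycle.
    neighbours-a+1 : ∀ {t} → Adj G (v (suc a)) t → In 0 e t
    neighbours-a+1 = start-neighbours
      (resize (lin 3 (λ e a A → # 1 ⊕ a ⊕ A ≈ e ∷ [] ⊢ # 1 ⊕ A ⊕ (# 1 ⊕ a) ≈ # 1 ⊕ e) (e ∷ a ∷ e ∸ suc a ∷ []) (m+[n∸m]≡n a<e))
        (widen (λ { (inj₁ p) → in-subset z≤n ≤-refl p ; (inj₂ p) → in-subset z≤n (<⇒≤ a<e) p })
          (join (up a<e e≤L) (adj-sym chord) (up z≤n a≤L) (in-disjoint′ ≤-refl e≤L))))
      (adj-sym attach) (up e<L ≤-refl) (in-disjoint ≤-refl ≤-refl)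
      (cong suc (trans (+-suc e (L ∸ suc e)) (m+[n∸m]≡n e<L)))

    a+1<e : suc a < e
    a+1<e = ≤∧≢⇒< a<e λ { refl → beyond (neighbours-a+1 (edge e<L)) }

    -- A cycle may omit one vertex of the path and still contradict c < L. Each of the next four
    -- lemmas excludes a pair of edges by such a cycle.
    ¬spanning : ∀ {x y Q ℓ} → Route x y Q ℓ → L ≤ ℓ → Adj G y x → ⊥
    ¬spanning r L≤ℓ a = <⇒≱ c<L (≤-trans L≤ℓ (closed r a))

    low-last : ∀ {y} → suc y ≤ a → Adj G (v (suc a)) (v (suc y)) → Adj G (v L) (v y) → ⊥
    low-last {y} y<a p q = ¬spanning
      (join₄ (up {0} {y} z≤n y≤L) (adj-sym q) (down e<L ≤-refl) attach (down y<a a≤L) (adj-sym p) (up a<e e≤L)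
        (in-disjoint (≤-trans y<a (≤-trans (<⇒≤ a<e) (n≤1+n e))) ≤-refl)
        (in-disjoint ≤-refl a≤L) (in-disjoint (m<n⇒m<1+n y<a) e≤L)
        (in-disjoint′ (m<n⇒m<1+n a<e) ≤-refl) (in-disjoint′ ≤-refl ≤-refl) (in-disjoint ≤-refl e≤L))
      (lin 7 (λ L e a y A B C → # 1 ⊕ e ⊕ A ≈ L ∷ # 1 ⊕ y ⊕ B ≈ a ∷ # 1 ⊕ a ⊕ C ≈ e ∷ [] ⊢
          L ≼ (# 1 ⊕ y) ⊕ ((# 1 ⊕ A) ⊕ ((# 1 ⊕ B) ⊕ (# 1 ⊕ C))))
        (L ∷ e ∷ a ∷ y ∷ L ∸ suc e ∷ a ∸ suc y ∷ e ∸ suc a ∷ [])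
        (m+[n∸m]≡n e<L) (m+[n∸m]≡n y<a) (m+[n∸m]≡n a<e))
      (adj-sym chord)
      where y≤L = ≤-trans (<⇒≤ y<a) a≤L

    first-last : Adj G (v (suc a)) (v 0) → Adj G (v L) (v e) → ⊥
    first-last p q = ¬spanning
      (join₃ (up {0} {a} z≤n a≤L) (adj-sym attach) (up e<L ≤-refl) q (down a<e e≤L)
        (in-disjoint (m<n⇒m<1+n a<e) ≤-refl) (in-disjoint ≤-refl e≤L) (in-disjoint′ ≤-refl ≤-refl))
      (lin 5 (λ L e a A C → # 1 ⊕ e ⊕ A ≈ L ∷ # 1 ⊕ a ⊕ C ≈ e ∷ [] ⊢
          L ≼ (# 1 ⊕ a) ⊕ ((# 1 ⊕ A) ⊕ (# 1 ⊕ C)))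
        (L ∷ e ∷ a ∷ L ∸ suc e ∷ e ∸ suc a ∷ []) (m+[n∸m]≡n e<L) (m+[n∸m]≡n a<e))
      p

    -- The cycle leaves out the vertices strictly between v y and v z; by `z ≤ 2 + y` there is at
    -- most one.
    start-last : ∀ {y z} → y < z → z ≤ 2 + y → z ≤ e → Adj G (v 0) (v z) → Adj G (v L) (v y) → ⊥
    start-last {y} {z} y<z z≤ z≤e p q = ¬spanning
      (join₃ (up {0} {y} z≤n y≤L) (adj-sym q) (down e<L ≤-refl) (adj-sym (edge e<L)) (down z≤e e≤L)
        (in-disjoint (≤-trans y<z (≤-trans z≤e (n≤1+n e))) ≤-refl) (in-disjoint y<z e≤L) (in-disjoint′ ≤-refl ≤-refl))
      (lin 6 (λ L e y z A C → # 1 ⊕ e ⊕ A ≈ L ∷ z ⊕ C ≈ e ∷ z ≼ # 2 ⊕ y ∷ [] ⊢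
          L ≼ (# 1 ⊕ y) ⊕ ((# 1 ⊕ A) ⊕ (# 1 ⊕ C)))
        (L ∷ e ∷ y ∷ z ∷ L ∸ suc e ∷ e ∸ z ∷ []) (m+[n∸m]≡n e<L) (m+[n∸m]≡n z≤e) z≤)
      (adj-sym p)
      where y≤L = ≤-trans (<⇒≤ y<z) (≤-trans z≤e e≤L)

    high-last : ∀ {y} → suc a ≤ y → 2 + y ≤ e → Adj G (v (suc a)) (v (2 + y)) → Adj G (v L) (v y) → ⊥
    high-last {y} a<y y+1<e p q = ¬spanning
      (join₄ (up a<y y≤L) (adj-sym q) (down e<L ≤-refl) attach (down {0} {a} z≤n a≤L) chord (down y+1<e e≤L)
        (in-disjoint (≤-trans (<⇒≤ y+1<e) (n≤1+n e)) ≤-refl) (in-disjoint′ ≤-refl y≤L) (in-disjoint (n≤1+n (suc y)) e≤L)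
        (in-disjoint′ (m<n⇒m<1+n a<e) ≤-refl) (in-disjoint′ ≤-refl ≤-refl)
        (in-disjoint (≤-trans a<y (≤-trans (n≤1+n y) (n≤1+n (suc y)))) e≤L))
      (lin 7 (λ L e a y A B C → # 1 ⊕ e ⊕ A ≈ L ∷ # 1 ⊕ a ⊕ B ≈ y ∷ # 2 ⊕ y ⊕ C ≈ e ∷ [] ⊢
          L ≼ (# 1 ⊕ B) ⊕ ((# 1 ⊕ A) ⊕ ((# 1 ⊕ a) ⊕ (# 1 ⊕ C))))
        (L ∷ e ∷ a ∷ y ∷ L ∸ suc e ∷ y ∸ suc a ∷ e ∸ (2 + y) ∷ [])
        (m+[n∸m]≡n e<L) (m+[n∸m]≡n a<y) (m+[n∸m]≡n y+1<e))
      (adj-sym p)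
      where y≤L = ≤-trans (≤-trans (n≤1+n y) (<⇒≤ y+1<e)) e≤L

    -- `s` counts v (a + 2), ..., v e, and `k` counts the tail without v L.
    s k : ℕ
    s = e ∸ suc a
    k = L ∸ suc e

    a+1+s≡e : suc a + s ≡ e
    a+1+s≡e = m+[n∸m]≡n a<e

    e+1+k≡L : suc e + k ≡ L
    e+1+k≡L = m+[n∸m]≡n e<L

    f w g : ℕ → ℕ
    f = neighbour (v 0)
    w = neighbour (v (suc a))
    g = neighbour (v L)

    f-sum : degree G (v 0) ≤ sumFrom f 1 a + sumFrom f (suc a) (suc s)
    f-sum = ≤-trans
      (degree-≤-sum (suc a + suc s) (trans (+-suc (suc a) s) (cong suc a+1+s≡e)) (hamiltonian-neighbours hamiltonian-0))
      (≤-reflexive (trans (sumFrom-split f 0 (suc a) (suc s))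
        (cong (λ z → z + sumFrom f 1 a + sumFrom f (suc a) (suc s)) (indicator-¬ _ adj-irrefl))))

    w-sum : degree G (v (suc a)) ≤ sumFrom w 0 (suc a) + sumFrom w (2 + a) s
    w-sum = ≤-trans
      (degree-≤-sum (suc a + suc s) (trans (+-suc (suc a) s) (cong suc a+1+s≡e)) neighbours-a+1)
      (≤-reflexive (trans (sumFrom-split w 0 (suc a) (suc s))
        (cong (λ z → sumFrom w 0 (suc a) + (z + sumFrom w (2 + a) s)) (indicator-¬ _ adj-irrefl))))

    g-sum : degree G (v L) ≤ sumFrom g 0 a + (g a + sumFrom g (suc a) s) + g e + k
    g-sum = ≤-trans
      (degree-≤-sum (suc e + (k + 1))
        (lin 3 (λ L e k → # 1 ⊕ e ⊕ k ≈ L ∷ [] ⊢ # 1 ⊕ e ⊕ (k ⊕ # 1) ≈ # 1 ⊕ L) (L ∷ e ∷ k ∷ []) e+1+k≡L)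
        (endpoint (down {0} {L} z≤n ≤-refl)))
      (lin 9 (λ D E K gL A B ge k gL′ →
          D ≈ E ⊕ (K ⊕ gL) ∷ E ≈ A ⊕ B ⊕ ge ∷ K ≼ k ∷ gL ≈ gL′ ⊕ # 0 ∷ gL′ ≈ # 0 ∷ [] ⊢ D ≼ A ⊕ B ⊕ ge ⊕ k)
        (sumFrom g 0 (suc e + (k + 1)) ∷ sumFrom g 0 (suc e) ∷ sumFrom g (suc e) k ∷ sumFrom g (suc e + k) 1 ∷
         sumFrom g 0 a ∷ (g a + sumFrom g (suc a) s) ∷ g e ∷ k ∷ g (suc e + k) ∷ [])
        (trans (sumFrom-split g 0 (suc e) (k + 1)) (cong (sumFrom g 0 (suc e) +_) (sumFrom-split g (suc e) k 1)))
        (trans (sumFrom-last g 0 e) (cong (_+ g e)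
          (trans (cong (sumFrom g 0) (trans (sym a+1+s≡e) (sym (+-suc a s)))) (sumFrom-split g 0 a (suc s)))))
        (sumFrom-≤ g (suc e) k λ i _ _ → indicator-≤1 (adj G (v L) (v i)))
        refl (indicator-¬ _ λ p → adj-irrefl (subst (λ i → Adj G (v L) (v i)) e+1+k≡L p)))

    -- Around the cycle v e precedes v 0, so `g e` stands for the missing term before `g 0`.
    low-columns : sumFrom f 1 a + sumFrom w 0 (suc a) + sumFrom g 0 a + g e ≤ a + 2
    low-columns = columns-≤ f w g (g e) 0 a (λ i → indicator-≤1 (adj G (v 0) (v i)))
      (exclusive₂ (adj G (v (suc a)) (v 0)) (adj G (v L) (v e)) first-last)
      (λ j _ j+1<a → exclusive₃ (adj G (v 0) (v (2 + j))) (adj G (v (suc a)) (v (1 + j))) (adj G (v L) (v j))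
        (λ p q → ¬hamiltonian (hamiltonian-low j+1<a a+1<e q p))
        (start-last (n≤1+n (suc j)) ≤-refl (≤-trans j+1<a (<⇒≤ a<e)))
        (low-last (<⇒≤ j+1<a)))
      (λ j _ eq → exclusive₂ (adj G (v (suc a)) (v (suc j))) (adj G (v L) (v j)) (low-last (≤-reflexive eq)))

    -- On the other arc v 0 and v (a + 1) exchange roles: both are successors of attachment
    -- vertices, and `g a` now fills the first column.
    high-columns : sumFrom w (2 + a) s + sumFrom f (suc a) (suc s) + sumFrom g (suc a) s + g a ≤ s + 2
    high-columns = columns-≤ w f g (g a) (suc a) s (λ i → indicator-≤1 (adj G (v (suc a)) (v i)))
      (exclusive₂ (adj G (v 0) (v (suc a))) (adj G (v L) (v a)) (start-last ≤-refl (n≤1+n (suc a)) a<e))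
      (λ j a<j j+1< → let j+1<e = subst (suc j <_) a+1+s≡e j+1< in
        exclusive₃ (adj G (v (suc a)) (v (2 + j))) (adj G (v 0) (v (1 + j))) (adj G (v L) (v j))
        (λ p q → ¬hamiltonian (hamiltonian-high (m<n⇒m<1+n a<j) j+1<e q p))
        (high-last a<j j+1<e)
        (start-last ≤-refl (n≤1+n (suc j)) (<⇒≤ j+1<e)))
      (λ j _ eq → exclusive₂ (adj G (v 0) (v (suc j))) (adj G (v L) (v j))
        (start-last ≤-refl (n≤1+n (suc j)) (≤-reflexive (trans eq a+1+s≡e))))

    -- The two arcs contribute at most (a + 2) + (s + 2) and the tail at most k, in all L + 2.
    3δ≤p+1 : ∀ {δ} → (∀ u → δ ≤ degree G u) → 3 * δ ≤ 2 + L
    3δ≤p+1 {δ} δ≤ =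
      lin 17 (λ δ L e a s k d₀ d₁ d₂ F₁ F₂ W₁ W₂ G₁ ga G₂ ge →
          δ ≼ d₀ ∷ δ ≼ d₁ ∷ δ ≼ d₂ ∷ d₀ ≼ F₁ ⊕ F₂ ∷ d₁ ≼ W₁ ⊕ W₂ ∷ d₂ ≼ G₁ ⊕ (ga ⊕ G₂) ⊕ ge ⊕ k ∷
          F₁ ⊕ W₁ ⊕ G₁ ⊕ ge ≼ a ⊕ # 2 ∷ W₂ ⊕ F₂ ⊕ G₂ ⊕ ga ≼ s ⊕ # 2 ∷ # 1 ⊕ a ⊕ s ≈ e ∷ # 1 ⊕ e ⊕ k ≈ L ∷ [] ⊢
          3 ⊗ δ ≼ # 2 ⊕ L)
        (δ ∷ L ∷ e ∷ a ∷ s ∷ k ∷ degree G (v 0) ∷ degree G (v (suc a)) ∷ degree G (v L) ∷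
          sumFrom f 1 a ∷ sumFrom f (suc a) (suc s) ∷ sumFrom w 0 (suc a) ∷ sumFrom w (2 + a) s ∷
          sumFrom g 0 a ∷ g a ∷ sumFrom g (suc a) s ∷ g e ∷ [])
        (δ≤ (v 0)) (δ≤ (v (suc a))) (δ≤ (v L)) f-sum w-sum g-sum low-columns high-columns a+1+s≡e e+1+k≡L

  -- Neighbours of the last vertex on the cycle

  module Tail (e : ℕ) (maximal : ∀ j → Lollipop j → j ≤ e)
    {v : ℕ → Fin n} (P : PathOn v L) (e<L : e < L) (chord : Adj G (v 0) (v e)) where

    open MaximalLollipop e maximal P e<L chord

    -- The cycle cut open just after v j, so that v j becomes the end at which a tail can be
    -- attached.
    record Rotation (j : ℕ) : Set where
      field
        first    : Fin n
        around   : Route first (v j) (In 0 e) (suc e)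
        closing  : Adj G first (v j)
        complete : ∀ {i} → i ≤ e → v i ∈ list around

    ∈-up : ∀ {lo hi i} (p : lo ≤ hi) (q : hi ≤ L) → lo ≤ i → i ≤ hi → v i ∈ list (up p q)
    ∈-up {lo} {hi} {i} p q lo≤i i≤hi = ∈-segment lo (suc (hi ∸ lo)) lo≤i
      (subst (i <_) (sym (trans (+-suc lo (hi ∸ lo)) (cong suc (m+[n∸m]≡n p)))) (s≤s i≤hi))

    rotate : ∀ {j} → j ≤ e → Rotation j
    rotate {j} j≤e with m≤n⇒m<n∨m≡n j≤e
    ... | inj₂ refl = record
      { first = v 0 ; around = up z≤n (<⇒≤ e<L) ; closing = chord ; complete = ∈-up z≤n (<⇒≤ e<L) z≤n }
    ... | inj₁ j<e = record
      { first    = v (suc j)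
      ; around   = resize
          (lin 3 (λ e j A → # 1 ⊕ j ⊕ A ≈ e ∷ [] ⊢ # 1 ⊕ A ⊕ (# 1 ⊕ j) ≈ # 1 ⊕ e) (e ∷ j ∷ e ∸ suc j ∷ []) (m+[n∸m]≡n j<e))
          (widen (λ { (inj₁ p) → in-subset z≤n ≤-refl p ; (inj₂ p) → in-subset z≤n j≤e p })
            (join (up j<e (<⇒≤ e<L)) (adj-sym chord) (up z≤n j≤L) (in-disjoint′ ≤-refl (<⇒≤ e<L))))
      ; closing  = adj-sym (edge (<-trans j<e e<L))
      ; complete = covered
      }
      where
      j≤L = ≤-trans j≤e (<⇒≤ e<L)
      covered : ∀ {i} → i ≤ e → v i ∈ list (up j<e (<⇒≤ e<L)) ++ list (up {0} {j} z≤n j≤L)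
      covered {i} i≤e with i ≤? j
      ... | yes i≤j = ∈-++⁺ʳ (list (up j<e (<⇒≤ e<L))) (∈-up {0} {j} z≤n j≤L z≤n i≤j)
      ... | no  i≰j = ∈-++⁺ˡ (∈-up j<e (<⇒≤ e<L) (≰⇒> i≰j) i≤e)

    -- Reversing the tail makes the two neighbours of v L on the cycle neighbours
    -- of the vertex next to the cycle.
    two-neighbours : ∀ {i j δ} → (∀ u → δ ≤ degree G u) → c < L → i ≤ e → j ≤ e → i ≢ j →
                     Adj G (v L) (v i) → Adj G (v L) (v j) → 3 * δ ≤ 2 + L
    two-neighbours {i} {j} {δ} δ≤ c<L i≤e j≤e i≢j p q = result (∈-nth {d = first} (complete i≤e))
      where
      open Rotation (rotate j≤e)
      tail = down e<L ≤-refl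
      k = L ∸ suc e
      whole = resize (cong suc (trans (+-suc e k) (m+[n∸m]≡n e<L)))
                (join around (adj-sym q) tail (in-disjoint ≤-refl ≤-refl))
      u = nth first (list whole)
      e< : e < length (list around)
      e< = ≤-reflexive (sym (size around))
      u-e : u e ≡ v j
      u-e = trans (nth-++ˡ (list around) e<) (trail-nth-last (trail around) (size around))
      u-e+1 : u (suc e) ≡ v L
      u-e+1 = trans (cong u (trans (sym (+-identityʳ (suc e))) (cong (_+ 0) (sym (size around)))))
                (trans (nth-++ʳ (list around)) (trail-nth-0 (trail tail)))
      result : (∃ λ a → a < length (list around) × nth first (list around) a ≡ v i) → 3 * δ ≤ 2 + L
      result (a , a< , eq) = Attached.3δ≤p+1 e maximal (route⇒pathOn first whole) e<L
        (subst (Adj G _) (sym u-e) (subst (λ x → Adj G x (v j)) (sym (trail-nth-0 (trail whole))) closing))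
        c<L a<e (subst (λ x → Adj G x (u a)) (sym u-e+1) (subst (Adj G (v L)) (sym u-a) p)) δ≤
        where
        u-a : u a ≡ v i
        u-a = trans (nth-++ˡ (list around) a<) eq
        a<e : a < e
        a<e = ≤∧≢⇒< (≤-pred (subst (a <_) (size around) a<))
          λ { refl → i≢j (injective (≤-trans i≤e (<⇒≤ e<L)) (≤-trans j≤e (<⇒≤ e<L)) (trans (sym u-a) u-e)) }

    -- All but one of the neighbours of v L are among the L - e - 1 other tail vertices, so δ ≤ L -
    -- e. Adding 2δ ≤ e + 1 gives even 3δ ≤ L + 1.
    few-neighbours : ∀ {δ} ys → (∀ u → δ ≤ degree G u) → 2 * δ ≤ suc e → length ys ≤ 1 →
                     (∀ {i} → i ≤ e → Adj G (v L) (v i) → v i ∈ ys) → 3 * δ ≤ 2 + L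
    few-neighbours {δ} ys δ≤ 2δ≤ ≤1 only =
      lin 6 (λ δ L e d y k → δ ≼ d ∷ d ≼ y ⊕ k ∷ y ≼ # 1 ∷ # 1 ⊕ e ⊕ k ≈ L ∷ 2 ⊗ δ ≼ # 1 ⊕ e ∷ [] ⊢ 3 ⊗ δ ≼ # 2 ⊕ L)
        (δ ∷ L ∷ e ∷ degree G (v L) ∷ length ys ∷ L ∸ suc e ∷ [])
        (δ≤ (v L))
        (subst (degree G (v L) ≤_) (trans (length-++ ys) (cong (length ys +_) (length-segment (suc e) (L ∸ suc e))))
          (degree-≤-length (v L) (ys ++ segment (suc e) (L ∸ suc e))
            λ t a → place a (endpoint (down {0} {L} z≤n ≤-refl) a)))
        ≤1 (m+[n∸m]≡n e<L) 2δ≤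
      where
      place : ∀ {t} → Adj G (v L) t → In 0 L t → t ∈ ys ++ segment (suc e) (L ∸ suc e)
      place a (i , _ , i≤L , refl) with i ≤? e
      ... | yes i≤e = ∈-++⁺ˡ (only i≤e a)
      ... | no  i≰e = ∈-++⁺ʳ ys (∈-segment (suc e) _ (≰⇒> i≰e)
                        (subst (i <_) (sym (m+[n∸m]≡n e<L)) (≤∧≢⇒< i≤L λ { refl → adj-irrefl a })))

    3δ≤p+1 : ∀ {δ} → (∀ u → δ ≤ degree G u) → TwoConnected G → c < L → 3 * δ ≤ 2 + L
    3δ≤p+1 {δ} δ≤ conn c<L with anyUpTo? (λ j → T? (adj G (v L) (v j))) (suc e)
    ... | no none = few-neighbours [] δ≤ (2δ≤e+1 δ≤ conn) z≤n
                      (λ i≤e a → ⊥-elim (none (_ , s≤s i≤e , a)))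
    ... | yes (j , s≤s j≤e , q) with anyUpTo? (λ i → ¬? (i ≟ j) ×-dec T? (adj G (v L) (v i))) (suc e)
    ...   | yes (i , s≤s i≤e , i≢j , p) = two-neighbours δ≤ c<L i≤e j≤e i≢j p q
    ...   | no none = few-neighbours [ v j ] δ≤ (2δ≤e+1 δ≤ conn) ≤-refl only
      where
      only : ∀ {i} → i ≤ e → Adj G (v L) (v i) → v i ∈ [ v j ]
      only {i} i≤e a with i ≟ j
      ... | yes refl = here refl
      ... | no  i≢j  = ⊥-elim (none (i , s≤s i≤e , i≢j , a))

  extremal : ∃ Lollipop → ((∃ λ e → Lollipop e × (∀ j → Lollipop j → j ≤ e)) → ⊥) → ⊥
  extremal = maximum Lollipop L (λ j → Lollipop.e≤L)

  -- For e = L the chord would close the whole path to a cycle with L + 1 vertices.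
  lollipop-bounded : c ≤ L → ∀ {e} → Lollipop e → e < L
  lollipop-bounded c≤L (lollipop v P e≤L chord) = ≤∧≢⇒< e≤L λ
    { refl → <⇒≱ (s≤s c≤L) (closed (Segments.up P z≤n ≤-refl) (adj-sym chord)) }

  2δ≤c : ∀ {δ} → (∀ u → δ ≤ degree G u) → TwoConnected G → ∃ Lollipop → c ≤ L → 2 * δ ≤ c
  2δ≤c {δ} δ≤ conn some c≤L with 2 * δ ≤? c
  ... | yes p = p
  ... | no ¬p = ⊥-elim (extremal some λ { (e , l@(lollipop v P e≤L chord) , maximal) →
    ¬p (≤-trans (MaximalLollipop.2δ≤e+1 e maximal P (lollipop-bounded c≤L l) chord δ≤ conn)
          (closed (Segments.up P z≤n e≤L) (adj-sym chord))) })

  3δ≤p+1 : ∀ {δ} → (∀ u → δ ≤ degree G u) → TwoConnected G → ∃ Lollipop → c < L → 3 * δ ≤ 2 + L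
  3δ≤p+1 {δ} δ≤ conn some c<L with 3 * δ ≤? 2 + L
  ... | yes p = p
  ... | no ¬p = ⊥-elim (extremal some λ { (e , l@(lollipop v P e≤L chord) , maximal) →
    ¬p (Tail.3δ≤p+1 e maximal P (lollipop-bounded (<⇒≤ c<L) l) chord δ≤ conn c<L) })

  -- Vines

  suffix : ∀ {s y x xs} → Trail s y xs → Unique xs → x ∈ xs →
           ∃ λ ys → Trail x y ys × Unique ys × (∀ {t} → t ∈ ys → t ∈ xs)
  suffix stop    u       (here refl) = _ , stop , u , id
  suffix (a ◂ t) u       (here refl) = _ , a ◂ t , u , id
  suffix (a ◂ t) (_ ∷ u) (there x∈)  = let ys , t′ , u′ , ⊆ = suffix t u x∈ in ys , t′ , u′ , there ∘ ⊆

  module Ears {v : ℕ → Fin n} (P : PathOn v L) where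

    open Segments P

    Off : Fin n → Set
    Off t = ∀ {i} → i ≤ L → t ≢ v i

    off-in : ∀ {lo hi t} → hi ≤ L → Off t → In lo hi t → ⊥
    off-in hi≤L off (i , _ , i≤hi , eq) = off (≤-trans i≤hi hi≤L) eq

    in-point : ∀ {lo hi i t} → hi < i → i ≤ L → In lo hi t → t ≡ v i → ⊥
    in-point hi<i i≤L p refl = in-disjoint hi<i i≤L p (_ , ≤-refl , ≤-refl , refl)

    position? : ∀ t → (∃ λ i → i ≤ L × t ≡ v i) ⊎ Off t
    position? t with anyUpTo? (λ i → t Fin.≟ v i) (suc L)
    ... | yes (i , s≤s i≤L , eq) = inj₁ (i , i≤L , eq)
    ... | no none                = inj₂ λ i≤L eq → none (_ , s≤s i≤L , eq)

    -- A walk to v k whose inner vertices lie off the path. Its vertices may repeat; `link⇒ear`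
    -- removes the repetitions.
    data Link : Fin n → ℕ → Set where
      arrive : ∀ {t k} → k ≤ L → Adj G t (v k) → Link t k
      via    : ∀ {t s k} → Adj G t s → Off s → Link s k → Link t k

    link-≤L : ∀ {t k} → Link t k → k ≤ L
    link-≤L (arrive k≤L _) = k≤L
    link-≤L (via _ _ l)    = link-≤L l

    -- All neighbours of the end v L are on the path, so the walk has no inner vertex.
    link-L : ∀ {t} → Link t L → Adj G t (v L)
    link-L (arrive _ a)  = a
    link-L (via _ off l) = ⊥-elim (off-in ≤-refl off (endpoint (down {0} {L} z≤n ≤-refl) (adj-sym (link-L l))))

    -- The last component bounds where an ear vertex can lead: any link from it is also one from the
    -- starting point v a, to which the greedy choice applies.
    EarVertex : ℕ → ℕ → Fin n → Set
    EarVertex a k t = t ≡ v k ⊎ (Off t × Link t k × (∀ {j} → Link t j → Link (v a) j))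

    record Ear (a k : ℕ) : Set where
      field
        {first} : Fin n
        {inner} : ℕ
        leave   : Adj G (v a) first
        arc     : Route first (v k) (EarVertex a k) (suc inner)

    link⇒ear : ∀ {a k} → Link (v a) k → Ear a k
    link⇒ear {a} {k} l = let x , _ , p , r = go id l in record { leave = p ; arc = r }
      where
      go : ∀ {t} → (∀ {j} → Link t j → Link (v a) j) → Link t k →
           ∃ λ x → ∃ λ ℓ → Adj G t x × Route x (v k) (EarVertex a k) (suc ℓ)
      go h (arrive _ p) = v k , 0 , p , widen inj₁ (point (v k))
      go h (via {s = s} p off l) with go (λ l′ → h (via p off l′)) l
      ... | x , ℓ , q , r with s ∈? list r
      ...   | no s∉ = s , suc ℓ , p , route (s ∷ list r) (q ◂ trail r)
                (All.tabulate (λ t∈ eq → s∉ (subst (_∈ list r) (sym eq) t∈)) ∷ unique r)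
                (λ { (here refl) → inj₂ (off , l , λ l′ → h (via p off l′)) ; (there t∈) → within r t∈ })
                (cong suc (size r))
      -- The walk returns to `s`, so the part of the route before `s` is a loop and is cut off.
      ...   | yes s∈ with suffix (trail r) (unique r) s∈
      ...     | (_ ∷ ys) , t , u , ⊆ = s , length ys , p , route _ t u (within r ∘ ⊆) refl

    ear-disjoint : ∀ {lo hi a k t} → hi < k → k ≤ L → In lo hi t → EarVertex a k t → ⊥
    ear-disjoint hi<k k≤L p (inj₁ eq)        = in-point hi<k k≤L p eq
    ear-disjoint hi<k k≤L p (inj₂ (off , _)) = off-in (≤-trans (<⇒≤ hi<k) k≤L) off p

    -- The ear and the path from v a to v k form a cycle with at least k - a + 1 vertices.
    ear-cycle : ∀ {a k} → a < k → Link (v a) k → suc k ≤ c + a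
    ear-cycle {a} {suc k} (s≤s a≤k) l =
      lin 5 (λ a k c A i → # 1 ⊕ i ⊕ (# 1 ⊕ A) ≼ c ∷ a ⊕ A ≈ k ∷ [] ⊢ # 2 ⊕ k ≼ c ⊕ a)
        (a ∷ k ∷ c ∷ k ∸ a ∷ inner ∷ [])
        (closed (join arc (adj-sym (edge k<L)) (down a≤k (<⇒≤ k<L)) λ p q → ear-disjoint ≤-refl k<L q p) leave)
        (m+[n∸m]≡n a≤k)
      where
      open Ear (link⇒ear l)
      k<L = link-≤L l

    -- Vertices off the path are kept only with the bound R on their links. An ear that reaches
    -- beyond R therefore cannot meet them.
    FrontVertex : ℕ → ℕ → Fin n → Set
    FrontVertex r R t = In 0 r t ⊎ t ≡ v R ⊎ (Off t × (∀ {j} → Link t j → j ≤ R))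

    -- The part of a cycle built so far, open at v r and v R. The next ear starts between these two;
    -- the end at v r is prolonged along the path to its start.
    Front : ℕ → ℕ → ℕ → Set
    Front r R = Route (v r) (v R) (FrontVertex r R)

    extend : ∀ {r R a ℓ} → r ≤ a → a < R → R ≤ L → Front r R ℓ →
             Route (v R) (v a) (FrontVertex a R) (ℓ + (a ∸ r))
    extend {r} {R} {a} {ℓ} r≤a a<R R≤L J with m≤n⇒m<n∨m≡n r≤a
    ... | inj₂ refl = resize (lin 2 (λ ℓ d → d ≈ # 0 ∷ [] ⊢ ℓ ≈ ℓ ⊕ d) (ℓ ∷ r ∸ r ∷ []) (n∸n≡0 r)) (backwards J)
    ... | inj₁ r<a = resize
        (lin 5 (λ r a ℓ A B → # 1 ⊕ r ⊕ A ≈ a ∷ r ⊕ B ≈ a ∷ [] ⊢ ℓ ⊕ (# 1 ⊕ A) ≈ ℓ ⊕ B) (r ∷ a ∷ ℓ ∷ a ∸ suc r ∷ a ∸ r ∷ [])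
          (m+[n∸m]≡n r<a) (m+[n∸m]≡n r≤a))
        (widen (λ { (inj₁ (inj₁ p)) → inj₁ (in-subset z≤n r≤a p)
                  ; (inj₁ (inj₂ p)) → inj₂ p
                  ; (inj₂ p)        → inj₁ (in-subset z≤n ≤-refl p) })
          (join (backwards J) (edge (≤-trans r<a a≤L)) (up r<a a≤L)
            λ { (inj₁ p) q               → in-disjoint ≤-refl a≤L p q
              ; (inj₂ (inj₁ p)) q        → in-point a<R R≤L q p
              ; (inj₂ (inj₂ (off , _))) q → off-in a≤L off q }))
      where a≤L = ≤-trans (<⇒≤ a<R) R≤L

    Reach : ℕ → ℕ → Set
    Reach r R = ∀ {a j} → a < r → Link (v a) j → j ≤ R

    -- Off the path the pieces are disjoint because an old vertex has links only up to r, while each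
    -- ear vertex has a link to R > r.
    append-ear : ∀ {a r R ℓ Q x} → a < r → r < R → Reach r R → (E : Ear a R) → R ≤ L →
                 (∀ {t} → Q t → In 0 r t ⊎ (Off t × (∀ {j} → Link t j → j ≤ r))) →
                 Route x (v a) Q ℓ → Route x (v R) (FrontVertex r R) (ℓ + suc (Ear.inner E))
    append-ear {a} {r} {R} a<r r<R reach E R≤L Q⊆ J =
      widen (λ { (inj₁ q) → old (Q⊆ q) ; (inj₂ q) → new q })
        (join J leave arc λ q → disjoint (Q⊆ q))
      where
      open Ear E
      disjoint : ∀ {t} → In 0 r t ⊎ (Off t × (∀ {j} → Link t j → j ≤ r)) → EarVertex a R t → ⊥
      disjoint (inj₁ p)           q                     = ear-disjoint r<R R≤L p q
      disjoint (inj₂ (off , _))   (inj₁ eq)             = off R≤L eq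
      disjoint (inj₂ (_ , bound)) (inj₂ (_ , link , _)) = <⇒≱ r<R (bound link)
      old : ∀ {t} → In 0 r t ⊎ (Off t × (∀ {j} → Link t j → j ≤ r)) → FrontVertex r R t
      old (inj₁ p)             = inj₁ p
      old (inj₂ (off , bound)) = inj₂ (inj₂ (off , λ l → ≤-trans (bound l) (<⇒≤ r<R)))
      new : ∀ {t} → EarVertex a R t → FrontVertex r R t
      new (inj₁ eq)              = inj₂ (inj₁ eq)
      new (inj₂ (off , _ , out)) = inj₂ (inj₂ (off , λ l → reach a<r (out l)))

    advance : ∀ {r R a S ℓ} → r ≤ a → a < R → R < S → Reach R S → (E : Ear a S) → S ≤ L →
              Front r R ℓ → Front R S (ℓ + (a ∸ r) + suc (Ear.inner E))
    advance {r} {R} {a} r≤a a<R R<S reach E S≤L J = append-ear a<R R<S reach E S≤L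
      (λ { (inj₁ p)           → inj₁ (in-subset z≤n (<⇒≤ a<R) p)
         ; (inj₂ (inj₁ refl)) → inj₁ (R , z≤n , ≤-refl , refl)
         ; (inj₂ (inj₂ q))    → inj₂ q })
      (extend r≤a a<R (≤-trans (<⇒≤ R<S) S≤L) J)

    -- Follow a walk from v 0 to v L in G - v r. Here `a` is the last visited position before r, and
    -- links from the current vertex are links from v a. The first arrival beyond r gives the ear.
    crossing-ear : ∀ {r} → TwoConnected G → 0 < r → r < L → ∃ λ k → r < k × ∃ λ a → a < r × Link (v a) k
    crossing-ear {r} (_ , _ , connected) 0<r r<L = go 0<r id (apart 0<r)
      (connected (v r) (v 0) (v L)
        (λ eq → <⇒≢ 0<r (injective z≤n (<⇒≤ r<L) eq)) (λ eq → <⇒≢ r<L (sym (injective ≤-refl (<⇒≤ r<L) eq))))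
      where
      apart : ∀ {i} → i < r → v i ≢ v L
      apart i<r eq = <⇒≢ (<-trans i<r r<L) (injective (≤-trans (<⇒≤ i<r) (<⇒≤ r<L)) ≤-refl eq)
      go : ∀ {u a} → a < r → (∀ {k} → Link u k → Link (v a) k) → u ≢ v L → Walk G (_≢ v r) u (v L) →
           ∃ λ k → r < k × ∃ λ a → a < r × Link (v a) k
      go a<r h u≢ (here _) = ⊥-elim (u≢ refl)
      go a<r h u≢ (step {w = w} _ p walk) with position? w
      ... | inj₂ off = go a<r (λ l → h (via p off l)) (off ≤-refl) walk
      ... | inj₁ (i , i≤L , refl) with <-cmp i r
      ...   | tri< i<r _ _  = go i<r id (apart i<r) walk
      ...   | tri≈ _ refl _ = ⊥-elim (walk-source walk refl)
      ...   | tri> _ _ r<i  = i , r<i , _ , a<r , h (arrive i≤L p)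

    farthest-ear : ∀ {r} → TwoConnected G → 0 < r → r < L →
                   ((∃ λ R → r < R × (∃ λ a → a < r × Link (v a) R) × Reach r R) → ⊥) → ⊥
    farthest-ear {r} conn 0<r r<L found with crossing-ear conn 0<r r<L
    ... | k , r<k , ear = maximum (λ k → ∃ λ a → a < r × Link (v a) k) L (λ { _ (_ , _ , l) → link-≤L l }) (k , ear)
      λ { (R , ear′ , max) → found (R , ≤-trans r<k (max k ear) , ear′ , λ a<r l → max _ (_ , a<r , l)) }

    -- Lengths along a greedy vine

    module Bound {δ : ℕ} (δ≤ : ∀ u → δ ≤ degree G u) (conn : TwoConnected G) where

      -- With m ears, 2 (L + 1) ≤ (m + 1) (c - 4) + 10.
      VineBound : Set
      VineBound = ∃ λ m → 2 * δ + m ≤ c + 2 × 2 * suc L + 4 * m ≤ suc m * c + 6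

      -- The greedy vine after h + 2 ears, in Dirac's notation: used counts the path
      -- vertices of the big cycle up to v r, skipped those in the gaps β₁, …, β.
      record State (h r R : ℕ) : Set where
        field
          {used skipped β₁ β ℓ₁ ℓ₂} : ℕ
          r<R     : r < R
          R<L     : R < L
          reach   : Reach r R
          long    : Front r R ℓ₁
          short   : Front r R ℓ₂
          ℓ₁-≥    : suc used ≤ ℓ₁
          ℓ₂-≥    : 3 + h + β₁ ≤ ℓ₂
          used-≥  : δ + h + 1 ≤ used
          total   : used + skipped ≡ suc r
          gaps    : 2 * skipped + 3 * h ≤ h * c + β₁ + β
          lastGap : β + R + 2 ≤ c + r

      module Continue {h r R} (S : State h r R) where
        open State S

        -- The path from v r to v R closes the front that lacks the first ear. The resulting cycle
        -- covers both the first gap and the gap before v R.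
        short-cycle : ℓ₂ + R ≤ suc c + r
        short-cycle = go R r<R R<L short
          where
          go : ∀ R → r < R → R < L → Front r R ℓ₂ → ℓ₂ + R ≤ suc c + r
          go (suc R) (s≤s r≤R) R<L J =
            lin 5 (λ l R r c d → l ⊕ d ≼ c ∷ r ⊕ d ≈ R ∷ [] ⊢ l ⊕ (# 1 ⊕ R) ≼ # 1 ⊕ c ⊕ r) (ℓ₂ ∷ R ∷ r ∷ c ∷ R ∸ r ∷ [])
              (closed (extend r≤R ≤-refl (<⇒≤ R<L) J) (edge (≤-trans (n≤1+n (suc R)) R<L))) (m+[n∸m]≡n r≤R)

        before-r : ∀ {a j} → R < j → Link (v a) j → r ≤ a
        before-r R<j l = ≮⇒≥ λ a<r → <⇒≱ R<j (reach a<r l)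

        -- With g = R - a - 1 the new gap, `lastGap` and r ≤ a give β + g + 3 ≤ c for two
        -- consecutive gaps; this is added to `gaps`.
        gaps-step : ∀ {a} → r ≤ a → a < R →
                    2 * (skipped + (R ∸ suc a)) + 3 * suc h ≤ c + h * c + β₁ + (R ∸ suc a)
        gaps-step {a} r≤a a<R = lin 10 (λ s h X b₁ b g c r R a →
            2 ⊗ s ⊕ 3 ⊗ h ≼ X ⊕ b₁ ⊕ b ∷ b ⊕ R ⊕ # 2 ≼ c ⊕ r ∷ r ≼ a ∷ # 1 ⊕ a ⊕ g ≈ R ∷ [] ⊢
            2 ⊗ (s ⊕ g) ⊕ 3 ⊗ (# 1 ⊕ h) ≼ c ⊕ X ⊕ b₁ ⊕ g)
          (skipped ∷ h ∷ h * c ∷ β₁ ∷ β ∷ R ∸ suc a ∷ c ∷ r ∷ R ∷ a ∷ []) gaps lastGap r≤a (m+[n∸m]≡n a<R)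

        next : ∀ {a S} → a < R → Link (v a) S → R < S → S < L → Reach R S → State (suc h) R S
        next {a} {S} a<R l R<S S<L reach′ = record
          { used = used + (a ∸ r) + 1 ; skipped = skipped + (R ∸ suc a) ; β₁ = β₁ ; β = R ∸ suc a
          ; r<R = R<S ; R<L = S<L ; reach = reach′
          ; long  = advance r≤a a<R R<S reach′ E (<⇒≤ S<L) long
          ; short = advance r≤a a<R R<S reach′ E (<⇒≤ S<L) short
          ; ℓ₁-≥ = lin 4 (λ u l d i → # 1 ⊕ u ≼ l ∷ [] ⊢ # 1 ⊕ (u ⊕ d ⊕ # 1) ≼ l ⊕ d ⊕ (# 1 ⊕ i))
              (used ∷ ℓ₁ ∷ a ∸ r ∷ Ear.inner E ∷ []) ℓ₁-≥
          ; ℓ₂-≥ = lin 5 (λ h b l d i → # 3 ⊕ h ⊕ b ≼ l ∷ [] ⊢ # 3 ⊕ (# 1 ⊕ h) ⊕ b ≼ l ⊕ d ⊕ (# 1 ⊕ i))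
              (h ∷ β₁ ∷ ℓ₂ ∷ a ∸ r ∷ Ear.inner E ∷ []) ℓ₂-≥
          ; used-≥ = lin 4 (λ δ h u d → δ ⊕ h ⊕ # 1 ≼ u ∷ [] ⊢ δ ⊕ (# 1 ⊕ h) ⊕ # 1 ≼ u ⊕ d ⊕ # 1)
              (δ ∷ h ∷ used ∷ a ∸ r ∷ []) used-≥
          ; total = lin 7 (λ u s r R a d g → u ⊕ s ≈ # 1 ⊕ r ∷ r ⊕ d ≈ a ∷ # 1 ⊕ a ⊕ g ≈ R ∷ [] ⊢
                u ⊕ d ⊕ # 1 ⊕ (s ⊕ g) ≈ # 1 ⊕ R)
              (used ∷ skipped ∷ r ∷ R ∷ a ∷ a ∸ r ∷ R ∸ suc a ∷ []) total (m+[n∸m]≡n r≤a) (m+[n∸m]≡n a<R)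
          ; gaps = gaps-step r≤a a<R
          ; lastGap = lin 5 (λ c a g R S → # 1 ⊕ S ≼ c ⊕ a ∷ # 1 ⊕ a ⊕ g ≈ R ∷ [] ⊢ g ⊕ S ⊕ # 2 ≼ c ⊕ R)
              (c ∷ a ∷ R ∸ suc a ∷ R ∷ S ∷ []) (ear-cycle (<-trans a<R R<S) l) (m+[n∸m]≡n a<R)
          }
          where
          E   = link⇒ear l
          r≤a = before-r R<S l

        -- The last ear is the edge from v a to v L, so there are h + 3 ears. By the choice of `a`
        -- the last gap contains no neighbour of v L, so the big cycle contains all of them.
        last-ear : ∀ {a} → a < R → Adj G (v L) (v a) → (∀ i → i < R × Adj G (v L) (v i) → i ≤ a) → VineBound
        last-ear {a} a<R p max = 3 + h ,
          lin 7 (λ δ h c u l d k →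
              δ ⊕ h ⊕ # 1 ≼ u ∷ # 1 ⊕ u ≼ l ∷ l ⊕ d ⊕ (# 1 ⊕ k) ≼ c ∷ δ ≼ # 1 ⊕ d ⊕ (# 1 ⊕ k) ∷ [] ⊢
              2 ⊗ δ ⊕ (# 3 ⊕ h) ≼ c ⊕ # 2)
            (δ ∷ h ∷ c ∷ used ∷ ℓ₁ ∷ a ∸ r ∷ L ∸ suc R ∷ [])
            used-≥ ℓ₁-≥ big-cycle end-degree ,
          lin 8 (λ L W D h X c b₁ g →
              # 1 ⊕ L ≈ W ⊕ D ∷ W ≼ c ∷ 2 ⊗ D ⊕ 3 ⊗ (# 1 ⊕ h) ≼ c ⊕ X ⊕ b₁ ⊕ g ∷ # 3 ⊕ h ⊕ b₁ ⊕ g ≼ c ∷ [] ⊢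
              2 ⊗ (# 1 ⊕ L) ⊕ 4 ⊗ (# 3 ⊕ h) ≼ c ⊕ (c ⊕ (c ⊕ (c ⊕ X))) ⊕ # 6)
            (L ∷ used + (a ∸ r) + suc (suc (L ∸ suc R)) ∷ skipped + (R ∸ suc a) ∷ h ∷ h * c ∷ c ∷ β₁ ∷ R ∸ suc a ∷ [])
            whole-path
            (lin 5 (λ l c u d k → # 1 ⊕ u ≼ l ∷ l ⊕ d ⊕ (# 1 ⊕ k) ≼ c ∷ [] ⊢ u ⊕ d ⊕ (# 2 ⊕ k) ≼ c)
              (ℓ₁ ∷ c ∷ used ∷ a ∸ r ∷ L ∸ suc R ∷ []) ℓ₁-≥ big-cycle)
            (gaps-step r≤a a<R)
            (lin 8 (λ l R h b₁ g c r a →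
                # 3 ⊕ h ⊕ b₁ ≼ l ∷ l ⊕ R ≼ # 1 ⊕ c ⊕ r ∷ r ≼ a ∷ # 1 ⊕ a ⊕ g ≈ R ∷ [] ⊢ # 3 ⊕ h ⊕ b₁ ⊕ g ≼ c)
              (ℓ₂ ∷ R ∷ h ∷ β₁ ∷ R ∸ suc a ∷ c ∷ r ∷ a ∷ []) ℓ₂-≥ short-cycle r≤a (m+[n∸m]≡n a<R))
          where
          r≤a = before-r R<L (arrive ≤-refl (adj-sym p))
          whole-path : suc L ≡ used + (a ∸ r) + suc (suc (L ∸ suc R)) + (skipped + (R ∸ suc a))
          whole-path = lin 9 (λ L R k a g d u s r →
              # 1 ⊕ R ⊕ k ≈ L ∷ # 1 ⊕ a ⊕ g ≈ R ∷ r ⊕ d ≈ a ∷ u ⊕ s ≈ # 1 ⊕ r ∷ [] ⊢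
              # 1 ⊕ L ≈ u ⊕ d ⊕ (# 2 ⊕ k) ⊕ (s ⊕ g))
            (L ∷ R ∷ L ∸ suc R ∷ a ∷ R ∸ suc a ∷ a ∸ r ∷ used ∷ skipped ∷ r ∷ [])
            (m+[n∸m]≡n R<L) (m+[n∸m]≡n a<R) (m+[n∸m]≡n r≤a) total
          big-cycle : ℓ₁ + (a ∸ r) + suc (L ∸ suc R) ≤ c
          big-cycle = closed (join (extend r≤a a<R (<⇒≤ R<L) long) (adj-sym p) (down R<L ≤-refl)
            λ { (inj₁ q) s               → in-disjoint (m<n⇒m<1+n a<R) ≤-refl q s
              ; (inj₂ (inj₁ refl)) s     → in-disjoint {R} {R} ≤-refl ≤-refl (R , ≤-refl , ≤-refl , refl) s
              ; (inj₂ (inj₂ (off , _))) s → off-in ≤-refl off s })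
            (adj-sym (edge R<L))
          end-degree : δ ≤ suc (a ∸ r) + suc (L ∸ suc R)
          end-degree = ≤-trans (δ≤ (v L)) (subst (degree G (v L) ≤_)
            (trans (length-++ (segment r (suc (a ∸ r)))) (cong₂ _+_ (length-segment r (suc (a ∸ r))) (length-segment R (suc (L ∸ suc R)))))
            (degree-≤-length (v L) (segment r (suc (a ∸ r)) ++ segment R (suc (L ∸ suc R)))
              λ t q → place q (endpoint (down {0} {L} z≤n ≤-refl) q)))
            where
            place : ∀ {t} → Adj G (v L) t → In 0 L t → t ∈ segment r (suc (a ∸ r)) ++ segment R (suc (L ∸ suc R))
            place q (i , _ , i≤L , refl) with i <? R
            ... | yes i<R = ∈-++⁺ˡ (∈-segment r _ (before-r R<L (arrive ≤-refl (adj-sym q)))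
                  (lin 4 (λ i a r d → i ≼ a ∷ r ⊕ d ≈ a ∷ [] ⊢ i ≺ r ⊕ (# 1 ⊕ d)) (i ∷ a ∷ r ∷ a ∸ r ∷ [])
                    (max i (i<R , q)) (m+[n∸m]≡n r≤a)))
            ... | no  i≮R = ∈-++⁺ʳ (segment r (suc (a ∸ r))) (∈-segment R _ (≮⇒≥ i≮R)
                  (lin 4 (λ i L R d → i ≺ L ∷ # 1 ⊕ R ⊕ d ≈ L ∷ [] ⊢ i ≺ R ⊕ (# 1 ⊕ d)) (i ∷ L ∷ R ∷ L ∸ suc R ∷ [])
                    (≤∧≢⇒< i≤L λ { refl → adj-irrefl q }) (m+[n∸m]≡n R<L)))

      finish : ∀ fuel {h r R} → State h r R → L ≤ R + fuel → (VineBound → ⊥) → ⊥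
      finish fuel {h} {r} {R} state L≤ none =
        farthest-ear conn (≤-trans (s≤s z≤n) r<R) R<L λ { (S , R<S , (a , a<R , l) , reach′) → cases R<S a<R l reach′ fuel L≤ }
        where
        open State state
        open Continue state
        cases : ∀ {S a} → R < S → a < R → Link (v a) S → Reach R S → ∀ fuel → L ≤ R + fuel → ⊥
        cases {S} {a} R<S a<R l reach′ fuel L≤ with m≤n⇒m<n∨m≡n (link-≤L l) | fuel
        -- An ear reaching v L is a single edge. It is replaced by the edge from the last neighbour
        -- of v L before v R.
        ... | inj₂ refl | _ = maximum (λ i → i < R × Adj G (v L) (v i)) R (λ _ (i<R , _) → <⇒≤ i<R)
                                (a , a<R , adj-sym (link-L l)) λ { (b , (b<R , p) , max) → none (last-ear b<R p max) }
        ... | inj₁ S<L  | zero  = <⇒≱ R<L (subst (L ≤_) (+-identityʳ R) L≤)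
        ... | inj₁ S<L  | suc f = finish f (next a<R l R<S S<L reach′)
                                    (≤-trans L≤ (subst (_≤ S + f) (sym (+-suc R f)) (+-monoˡ-≤ f R<S))) none

      -- The first ear is the edge from v 0 to v b. By `between` the first gap, strictly between v a
      -- and v b, contains no neighbour of v 0; all of them lie on the big cycle.
      module Begin {r a b R : ℕ} (r<L : r < L) (0~r : ∀ {t} → Adj G (v 0) t → In 0 r t)
        (a<r : a < r) (a<b : a < b) (b≤r : b ≤ r) (0~b : Adj G (v 0) (v b))
        (between : ∀ i → a < i × Adj G (v 0) (v i) → b ≤ i) (r<R : r < R) (l : Link (v a) R) where

        r≤L : r ≤ L
        r≤L = <⇒≤ r<L

        -- Three cycles, one for each ear and one through both, give 2 L + 4 ≤ 3 c.
        two-ears : R ≡ L → 2 * δ ≤ c → VineBound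
        two-ears refl 2δ≤c = 2 , +-monoˡ-≤ 2 2δ≤c ,
          lin 5 (λ L c a b d → # 1 ⊕ b ≼ c ∷ # 1 ⊕ L ≼ c ⊕ a ∷ # 1 ⊕ a ⊕ (# 1 ⊕ d) ≼ c ∷ b ⊕ d ≈ L ∷ [] ⊢
              2 ⊗ (# 1 ⊕ L) ⊕ # 8 ≼ c ⊕ (c ⊕ (c ⊕ # 0)) ⊕ # 6)
            (L ∷ c ∷ a ∷ b ∷ L ∸ b ∷ [])
            (closed (up z≤n (≤-trans b≤r r≤L)) (adj-sym 0~b))
            (ear-cycle (<-trans a<r r<L) l)
            (closed (join (up {0} {a} z≤n (≤-trans (<⇒≤ a<r) r≤L)) (link-L l) (down (≤-trans b≤r r≤L) ≤-refl)
              (in-disjoint a<b ≤-refl)) (adj-sym 0~b))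
            (m+[n∸m]≡n (≤-trans b≤r r≤L))

        start-degree : δ ≤ a + suc (r ∸ b)
        start-degree = ≤-trans (δ≤ (v 0)) (subst (degree G (v 0) ≤_)
          (trans (length-++ (segment 1 a)) (cong₂ _+_ (length-segment 1 a) (length-segment b (suc (r ∸ b)))))
          (degree-≤-length (v 0) (segment 1 a ++ segment b (suc (r ∸ b))) λ t q → place q (0~r q)))
          where
          place : ∀ {t} → Adj G (v 0) t → In 0 r t → t ∈ segment 1 a ++ segment b (suc (r ∸ b))
          place q (i , _ , i≤r , refl) with i ≤? a
          ... | yes i≤a = ∈-++⁺ˡ (∈-segment 1 a (n≢0⇒n>0 λ { refl → adj-irrefl q }) (s≤s i≤a))
          ... | no  i≰a = ∈-++⁺ʳ (segment 1 a) (∈-segment b _ (between i (≰⇒> i≰a , q))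
                (lin 4 (λ i r b d → i ≼ r ∷ b ⊕ d ≈ r ∷ [] ⊢ i ≺ b ⊕ (# 1 ⊕ d)) (i ∷ r ∷ b ∷ r ∸ b ∷ [])
                  i≤r (m+[n∸m]≡n b≤r)))

        start : R < L → Reach r R → State 0 r R
        start R<L reach = record
          { used = suc (r ∸ b) + suc a ; skipped = b ∸ suc a ; β₁ = b ∸ suc a ; β = b ∸ suc a
          ; r<R = r<R ; R<L = R<L ; reach = reach
          ; long = append-ear a<r r<R reach E (<⇒≤ R<L)
              (λ { (inj₁ p) → inj₁ (in-subset z≤n ≤-refl p) ; (inj₂ p) → inj₁ (in-subset z≤n (<⇒≤ a<r) p) })
              (join (down b≤r r≤L) (adj-sym 0~b) (up {0} {a} z≤n (≤-trans (<⇒≤ a<r) r≤L)) (in-disjoint′ a<b r≤L))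
          ; short = append-ear a<r r<R reach E (<⇒≤ R<L) (λ p → inj₁ (in-subset z≤n ≤-refl p)) (down (<⇒≤ a<r) r≤L)
          ; ℓ₁-≥ = lin 2 (λ u i → [] ⊢ # 1 ⊕ u ≼ u ⊕ (# 1 ⊕ i)) (suc (r ∸ b) + suc a ∷ Ear.inner E ∷ [])
          ; ℓ₂-≥ = lin 6 (λ g d i a b r → # 1 ⊕ a ⊕ g ≈ b ∷ a ⊕ d ≈ r ∷ b ≼ r ∷ [] ⊢ # 3 ⊕ g ≼ # 1 ⊕ d ⊕ (# 1 ⊕ i))
              (b ∸ suc a ∷ r ∸ a ∷ Ear.inner E ∷ a ∷ b ∷ r ∷ []) (m+[n∸m]≡n a<b) (m+[n∸m]≡n (<⇒≤ a<r)) b≤r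
          ; used-≥ = lin 3 (λ δ a d → δ ≼ a ⊕ (# 1 ⊕ d) ∷ [] ⊢ δ ⊕ # 0 ⊕ # 1 ≼ # 1 ⊕ d ⊕ (# 1 ⊕ a))
              (δ ∷ a ∷ r ∸ b ∷ []) start-degree
          ; total = lin 5 (λ g d a b r → # 1 ⊕ a ⊕ g ≈ b ∷ b ⊕ d ≈ r ∷ [] ⊢ # 1 ⊕ d ⊕ (# 1 ⊕ a) ⊕ g ≈ # 1 ⊕ r)
              (b ∸ suc a ∷ r ∸ b ∷ a ∷ b ∷ r ∷ []) (m+[n∸m]≡n a<b) (m+[n∸m]≡n b≤r)
          ; gaps = lin 1 (λ g → [] ⊢ 2 ⊗ g ⊕ # 0 ≼ # 0 ⊕ g ⊕ g) (b ∸ suc a ∷ [])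
          ; lastGap = lin 6 (λ g a b r R c → # 1 ⊕ a ⊕ g ≈ b ∷ b ≼ r ∷ # 1 ⊕ R ≼ c ⊕ a ∷ [] ⊢ g ⊕ R ⊕ # 2 ≼ c ⊕ r)
              (b ∸ suc a ∷ a ∷ b ∷ r ∷ R ∷ c ∷ []) (m+[n∸m]≡n a<b) b≤r (ear-cycle (<-trans a<r r<R) l)
          }
          where E = link⇒ear l

      vine-bound : 0 < L → c ≤ L → 2 * δ ≤ c → (VineBound → ⊥) → ⊥
      vine-bound 0<L c≤L 2δ≤c none =
        maximum (λ i → i ≤ L × Adj G (v 0) (v i)) L (λ _ → proj₁) (1 , 0<L , edge 0<L) from-last
        where
        from-last : (∃ λ r → (r ≤ L × Adj G (v 0) (v r)) × (∀ i → i ≤ L × Adj G (v 0) (v i) → i ≤ r)) → ⊥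
        from-last (r , (r≤L , 0~r) , max) = farthest-ear conn 0<r r<L λ { (R , r<R , (a , a<r , l) , reach) →
            minimum (λ b → a < b × Adj G (v 0) (v b)) (r , a<r , 0~r) λ { (b , (a<b , 0~b) , min) →
              conclude reach (link-≤L l) a<r a<b (min r (a<r , 0~r)) 0~b min r<R l } }
          where
          0<r : 0 < r
          0<r = ≤-trans (s≤s z≤n) (max 1 (0<L , edge 0<L))
          r<L : r < L
          r<L = ≤∧≢⇒< r≤L λ { refl → <⇒≱ (s≤s c≤L) (closed (up {0} {L} z≤n ≤-refl) (adj-sym 0~r)) }
          inside : ∀ {t} → Adj G (v 0) t → In 0 r t
          inside p with endpoint (up {0} {L} z≤n ≤-refl) p
          ... | i , _ , i≤L , refl = i , z≤n , max i (i≤L , p) , refl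
          conclude : ∀ {a b R} → Reach r R → R ≤ L → a < r → a < b → b ≤ r → Adj G (v 0) (v b) →
                     (∀ i → a < i × Adj G (v 0) (v i) → b ≤ i) → r < R → Link (v a) R → ⊥
          conclude reach R≤L a<r a<b b≤r 0~b min r<R l with m≤n⇒m<n∨m≡n R≤L
          ... | inj₂ R≡L = none (two-ears R≡L 2δ≤c)
            where open Begin r<L inside a<r a<b b≤r 0~b min r<R l
          ... | inj₁ R<L = finish L (start R<L reach) (m≤n+m L _) none
            where open Begin r<L inside a<r a<b b≤r 0~b min r<R l

-- Minimum degree two, the quadratic form and the theorem

avoid-two : ∀ {n} → 3 ≤ n → (x y : Fin n) → ∃ λ z → z ≢ x × z ≢ y
avoid-two (s≤s (s≤s (s≤s _))) zero          zero          = suc zero , (λ ()) , (λ ())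
avoid-two (s≤s (s≤s (s≤s _))) zero          (suc zero)    = suc (suc zero) , (λ ()) , (λ ())
avoid-two (s≤s (s≤s (s≤s _))) zero          (suc (suc _)) = suc zero , (λ ()) , (λ ())
avoid-two (s≤s (s≤s (s≤s _))) (suc zero)    zero          = suc (suc zero) , (λ ()) , (λ ())
avoid-two (s≤s (s≤s (s≤s _))) (suc (suc _)) zero          = suc zero , (λ ()) , (λ ())
avoid-two (s≤s (s≤s (s≤s _))) (suc _)       (suc _)       = zero , (λ ()) , (λ ())

-- A walk leaving v yields a neighbour x, and a walk leaving v in G - x yields a second one.
twoConnected⇒2≤degree : ∀ {n} (G : Graph n) → TwoConnected G → ∀ v → 2 ≤ degree G v
twoConnected⇒2≤degree {n} G (3≤n , connected , connected₂) v = case-first (leave (connected v z) (z≢v ∘ sym))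
  where
  open Routes G
  z   = proj₁ (avoid-two 3≤n v v)
  z≢v = proj₁ (proj₂ (avoid-two 3≤n v v))
  leave : ∀ {A : Fin n → Set} {u w} → Walk G A u w → u ≢ w → ∃ λ x → Adj G u x × A x
  leave (here _)        u≢u = ⊥-elim (u≢u refl)
  leave (step _ a walk) _   = _ , a , walk-source walk
  case-first : (∃ λ x → Adj G v x × ⊤) → 2 ≤ degree G v
  case-first (x , v~x , _) with avoid-two 3≤n v x
  ... | y , y≢v , y≢x with leave (connected₂ x v y (λ { refl → adj-irrefl v~x }) y≢x) (y≢v ∘ sym)
  ...   | w , v~w , w≢x = unique-⊆-length {xs = w ∷ x ∷ []} ((w≢x ∷ []) ∷ [] ∷ []) λ
    { (here refl)         → ∈-filter⁺ (T? ∘ adj G v) (∈-allFin w) v~w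
    ; (there (here refl)) → ∈-filter⁺ (T? ∘ adj G v) (∈-allFin x) v~x }

open import Data.Integer.Base using (ℤ; +_; _-_; +≤+) renaming (_≤_ to _≤ℤ_; _*_ to _*ℤ_; _+_ to _+ℤ_)

-- With c = j + 4 and k = c - 2δ + 3, the two squares are (j + k)² and (j - k)².
square-form : ∀ {p c δ j k} → c ≡ 4 + j → c + 3 ≡ 2 * δ + k → 2 * p ≤ k * j + 10 →
  (+ (8 * p) - + 40) +ℤ ((+ (2 * δ) - + 7) *ℤ (+ (2 * δ) - + 7))
    ≤ℤ (+ (2 * c) - + (2 * δ + 1)) *ℤ (+ (2 * c) - + (2 * δ + 1))
square-form {p} {c} {δ} {j} {k} c≡ k≡ 2p≤ =
  subst₂ (λ x y → (+ (8 * p) - + 40) +ℤ (x *ℤ x) ≤ℤ y *ℤ y) (sym left) (sym right)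
    (subst ((+ (8 * p) - + 40) +ℤ ((+ j - + k) *ℤ (+ j - + k)) ≤ℤ_) (sym (squares (+ j) (+ k)))
      (ℤ.+-monoˡ-≤ ((+ j - + k) *ℤ (+ j - + k)) product))
  where
  cancel : ∀ a b x y → a + y ≡ x + b → + a - + b ≡ + x - + y
  cancel a b x y eq = trans (shift (+ a) (+ b) (+ y)) (trans (cong (λ z → z - (+ b +ℤ + y)) (cong +_ eq)) (unshift (+ x) (+ b) (+ y)))
    where
    shift : ∀ a b y → a - b ≡ (a +ℤ y) - (b +ℤ y)
    shift = solve-∀
    unshift : ∀ x b y → (x +ℤ b) - (b +ℤ y) ≡ x - y
    unshift = solve-∀
  left : + (2 * δ) - + 7 ≡ + j - + k
  left = cancel (2 * δ) 7 j k
    (lin 4 (λ c δ j k → c ≈ # 4 ⊕ j ∷ c ⊕ # 3 ≈ 2 ⊗ δ ⊕ k ∷ [] ⊢ 2 ⊗ δ ⊕ k ≈ j ⊕ # 7) (c ∷ δ ∷ j ∷ k ∷ []) c≡ k≡)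
  right : + (2 * c) - + (2 * δ + 1) ≡ + j +ℤ + k
  right = trans (cancel (2 * c) (2 * δ + 1) (j + k) 0
    (lin 4 (λ c δ j k → c ≈ # 4 ⊕ j ∷ c ⊕ # 3 ≈ 2 ⊗ δ ⊕ k ∷ [] ⊢ 2 ⊗ c ⊕ # 0 ≈ j ⊕ k ⊕ (2 ⊗ δ ⊕ # 1))
      (c ∷ δ ∷ j ∷ k ∷ []) c≡ k≡)) (ℤ.+-identityʳ _)
  squares : ∀ j k → (j +ℤ k) *ℤ (j +ℤ k) ≡ + 4 *ℤ (k *ℤ j) +ℤ (j - k) *ℤ (j - k)
  squares = solve-∀
  product : + (8 * p) - + 40 ≤ℤ + 4 *ℤ (+ k *ℤ + j)
  product = subst (+ (8 * p) - + 40 ≤ℤ_)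
    (trans (cancel (4 * (k * j) + 40) 40 (4 * (k * j)) 0 (+-identityʳ _))
      (trans (ℤ.+-identityʳ _) (trans (ℤ.pos-* 4 (k * j)) (cong (+ 4 *ℤ_) (ℤ.pos-* k j)))))
    (ℤ.+-monoˡ-≤ (ℤ.- + 40) (+≤+
      (lin 2 (λ p q → 2 ⊗ p ≼ q ⊕ # 10 ∷ [] ⊢ 8 ⊗ p ≼ 4 ⊗ q ⊕ # 40) (p ∷ k * j ∷ []) 2p≤)))

theorem1 : ∀ {n} (G : Graph n) (δ p c : ℕ) →
    TwoConnected G → MinDegree G δ → LongestPathOrder G p → Circumference G c →
    (p ≤ 2 * δ → p ≤ c) ×
    (2 * δ + 1 ≤ p → p + 2 ≤ 3 * δ → p ∸ 1 ≤ c) ×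
    (3 * δ ≤ p + 1 →
    (2 * δ + 1 ≤ 2 * c) ×
    ((+ (8 * p) - + 40) +ℤ ((+ (2 * δ) - + 7) *ℤ (+ (2 * δ) - + 7))
    ≤ℤ (+ (2 * c) - + (2 * δ + 1)) *ℤ (+ (2 * c) - + (2 * δ + 1))))
theorem1 {n} G δ p c conn ((u , refl) , δ≤) ((x ∷ xs , (uniq , chain) , refl) , longest) ((y ∷ ys , (3≤ , _) , refl) , cycle-≤) =
  part₁ , part₂ , λ 3δ≤ → 2δ<2c 3δ≤ , square-form {p} {δ = δ} (c≡ 3δ≤) (k≡ 3δ≤) (bound 3δ≤)
  where
  L = length xs
  open Longest G L c longest cycle-≤ 3≤ using (Route; route; PathOn; route⇒pathOn; chain⇒trail; Lollipop; lollipop; 2δ≤c; 3δ≤p+1; module Ears)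

  whole : Route x (proj₁ (chain⇒trail chain)) (λ _ → ⊤) (suc L)
  whole = route (x ∷ xs) (proj₂ (chain⇒trail chain)) uniq _ refl

  path : PathOn (nth x (x ∷ xs)) L
  path = route⇒pathOn x whole

  0<L : c ≤ L → 0 < L
  0<L c≤L = ≤-trans (s≤s z≤n) (≤-trans 3≤ c≤L)

  some : c ≤ L → ∃ Lollipop
  some c≤L = 1 , lollipop _ path (0<L c≤L) (PathOn.edge path (0<L c≤L))

  2≤δ : 2 ≤ δ
  2≤δ = twoConnected⇒2≤degree G conn u

  part₁ : p ≤ 2 * δ → p ≤ c
  part₁ p≤2δ with p ≤? c
  ... | yes p≤c = p≤c
  ... | no  p≰c = ≤-trans p≤2δ (2δ≤c δ≤ conn (some c≤L) c≤L)
    where c≤L = ≤-pred (≰⇒> p≰c)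

  part₂ : 2 * δ + 1 ≤ p → p + 2 ≤ 3 * δ → p ∸ 1 ≤ c
  part₂ _ p+2≤3δ with L ≤? c
  ... | yes L≤c = L≤c
  ... | no  L≰c = ⊥-elim (n≮0 (lin 2 (λ L δ → # 1 ⊕ L ⊕ # 2 ≼ 3 ⊗ δ ∷ 3 ⊗ δ ≼ # 2 ⊕ L ∷ [] ⊢ # 1 ≼ # 0) (L ∷ δ ∷ [])
                    p+2≤3δ (3δ≤p+1 δ≤ conn (some (<⇒≤ (≰⇒> L≰c))) (≰⇒> L≰c))))

  module _ (3δ≤ : 3 * δ ≤ p + 1) where

    2δ≤ : 2 * δ ≤ c
    2δ≤ with p ≤? c
    ... | yes p≤c = lin 3 (λ p δ c → 3 ⊗ δ ≼ p ⊕ # 1 ∷ p ≼ c ∷ # 2 ≼ δ ∷ [] ⊢ 2 ⊗ δ ≼ c) (p ∷ δ ∷ c ∷ []) 3δ≤ p≤c 2≤δ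
    ... | no  p≰c = 2δ≤c δ≤ conn (some (≤-pred (≰⇒> p≰c))) (≤-pred (≰⇒> p≰c))

    2δ<2c : 2 * δ + 1 ≤ 2 * c
    2δ<2c = lin 2 (λ δ c → 2 ⊗ δ ≼ c ∷ # 2 ≼ δ ∷ [] ⊢ 2 ⊗ δ ⊕ # 1 ≼ 2 ⊗ c) (δ ∷ c ∷ []) 2δ≤ 2≤δ

    j k : ℕ
    j = c ∸ 4
    k = c + 3 ∸ 2 * δ

    c≡ : c ≡ 4 + j
    c≡ = sym (m+[n∸m]≡n (≤-trans (*-monoʳ-≤ 2 2≤δ) 2δ≤))

    k≡ : c + 3 ≡ 2 * δ + k
    k≡ = sym (m+[n∸m]≡n (≤-trans 2δ≤ (m≤m+n c 3)))

    scaled : ∀ m → m ≤ k → m * j ≤ k * j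
    scaled m m≤k = *-monoˡ-≤ j m≤k

    bound : 2 * p ≤ k * j + 10
    bound with p ≤? c
    ... | yes p≤c = lin 4 (λ p c j q → p ≼ c ∷ c ≈ # 4 ⊕ j ∷ 2 ⊗ j ≼ q ∷ [] ⊢ 2 ⊗ p ≼ q ⊕ # 10) (p ∷ c ∷ j ∷ k * j ∷ [])
          p≤c c≡ (scaled 2 (lin 3 (λ c δ k → c ⊕ # 3 ≈ 2 ⊗ δ ⊕ k ∷ 2 ⊗ δ ≼ c ∷ [] ⊢ # 2 ≼ k) (c ∷ δ ∷ k ∷ []) k≡ 2δ≤))
    ... | no  p≰c = decidable-stable (2 * p ≤? k * j + 10) λ ¬bound →
          vine-bound (0<L c≤L) c≤L 2δ≤ λ { (m , few , long) → ¬bound (from-vine few long) }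
      where
      c≤L = ≤-pred (≰⇒> p≰c)
      open Ears path
      open Bound δ≤ conn
      -- `few` says m + 1 ≤ k, and with c = 4 + j `long` becomes 2 p ≤ (m + 1) j + 10.
      from-vine : ∀ {m} → 2 * δ + m ≤ c + 2 → 2 * p + 4 * m ≤ suc m * c + 6 → 2 * p ≤ k * j + 10
      from-vine {m} few long =
        lin 5 (λ p m X Y q → 2 ⊗ p ⊕ 4 ⊗ m ≼ X ⊕ # 6 ∷ X ≈ 4 ⊗ (# 1 ⊕ m) ⊕ Y ∷ Y ≼ q ∷ [] ⊢ 2 ⊗ p ≼ q ⊕ # 10)
          (p ∷ m ∷ suc m * c ∷ suc m * j ∷ k * j ∷ []) long
          (trans (cong (suc m *_) c≡) (trans (*-distribˡ-+ (suc m) 4 j) (cong (_+ suc m * j) (*-comm (suc m) 4))))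
          (scaled (suc m) (lin 4 (λ c δ k m → c ⊕ # 3 ≈ 2 ⊗ δ ⊕ k ∷ 2 ⊗ δ ⊕ m ≼ c ⊕ # 2 ∷ [] ⊢ # 1 ⊕ m ≼ k)
            (c ∷ δ ∷ k ∷ m ∷ []) k≡ few))
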